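{- Let $G$ be an HZ-graph with maximum degree $\Delta\ge 7$ and let $u,r\in V_\Delta$. If $N_{\Delta-1}(u)\ne N_{\Delta-1}(r)$ and $N_{\Delta-1}(u)\cap N_{\Delta-1}(r)\neq\emptyset$, then $|N_{\Delta-1}(u)\cap N_{\Delta-1}(r)|=\Delta-3$, i.e. $|N_{\Delta-1}(u)\setminus N_{\Delta-1}(r)|=|N_{\Delta-1}(r)\setminus N_{\Delta-1}(u)|=1$.
   Context: All graphs are simple. An HZ-graph is a connected graph $G$ of class 2 (i.e. $\chi'(G)=\Delta+1$ where $\Delta$ is the maximum degree of $G$) such that the core $G_\Delta$ (the subgraph induced by the vertices of degree $\Delta$) has maximum degree at most 2. $V_i$ denotes the set of vertices of degree $i$ in $G$, and $N_i(v)=N_G(v)\cap V_i$. -}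

module Defs where

open import Data.Nat using (ℕ; zero; suc; _⊔_; _≡ᵇ_; _≤_)
open import Data.Bool using (Bool; true; false; if_then_else_; _∧_)
open import Data.Fin using (Fin)
open import Data.Fin.Subset using (Subset; inside; outside; ∣_∣)
open import Data.Vec using (tabulate; foldr′)
open import Relation.Binary.PropositionalEquality using (_≡_; _≢_)
open import Data.Product using (∃; _×_)
open import Relation.Nullary using (¬_)

record SimpleGraph (n : ℕ) : Set where
  field
    adj   : Fin n → Fin n → Bool
    sym   : ∀ u v → adj u v ≡ adj v u
    irrefl : ∀ v → adj v v ≡ false

module _ {n : ℕ} (G : SimpleGraph n) where
  open SimpleGraph G

  toSide : Bool → _
  toSide true  = inside
  toSide false = outside

  N : Fin n → Subset n
  N v = tabulate (λ w → toSide (adj v w))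

  deg : Fin n → ℕ
  deg v = ∣ N v ∣

  maxDeg : ℕ
  maxDeg = foldr′ _⊔_ 0 (tabulate deg)

  Nd : ℕ → Fin n → Subset n
  Nd i v = tabulate (λ w → toSide (adj v w ∧ (deg w ≡ᵇ i)))

  data Reach : Fin n → Fin n → Set where
    here : ∀ {v} → Reach v v
    step : ∀ {u v w} → adj u v ≡ true → Reach v w → Reach u w

  Connected : Set
  Connected = ∀ u v → Reach u v

  record EdgeColouring (k : ℕ) : Set where
    field
      col     : Fin n → Fin n → Fin k
      col-sym : ∀ u v → adj u v ≡ true → col u v ≡ col v u
      proper  : ∀ v w w' → adj v w ≡ true → adj v w' ≡ true → w ≢ w' →
                col v w ≢ col v w'

  Class2 : Set
  Class2 = EdgeColouring (suc maxDeg) × ¬ EdgeColouring maxDeg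

  CoreMaxDeg≤2 : Set
  CoreMaxDeg≤2 = ∀ v → deg v ≡ maxDeg → ∣ Nd maxDeg v ∣ ≤ 2

  HZGraph : Set
  HZGraph = Connected × Class2 × CoreMaxDeg≤2

-- If the two neighbourhoods meet they coincide, so the hypotheses are contradictory. Deleting edges one by
-- one leads to an edge-critical subgraph; if it missed an edge of G, one of its core vertices would have
-- three core neighbours, so G itself is critical and has, for every edge e, a colouring in which only e is
-- uncoloured. For a core edge rx left uncoloured, let w be a neighbour of x of degree Δ - 1 that is not
-- adjacent to r and misses the colour missing at x. Counting the colours missing around x, fans at r and
-- Kempe changes turn such a w into a colouring of the whole of G; hence r and x have the same neighbours of
-- degree Δ - 1. Now leave rs uncoloured, where s is a neighbour of r of degree Δ - 1. The colours missing at r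
-- and its neighbours of degree Δ - 1 are all distinct, every colour is among them, and any two of these
-- vertices are the ends of a common Kempe chain. If another core neighbour u of s had a neighbour w of degree
-- Δ - 1 not adjacent to r, Kempe changes would make w a third end of such a chain.

module Submission where

open import Defs
open import Data.Bool using (Bool; true; false; _∧_; not)
import Data.Bool as Bool
open import Data.Empty using (⊥; ⊥-elim)
open import Data.Fin using (Fin; zero; suc; _≟_; fromℕ<)
open import Data.Fin.Properties using (all?; any?; suc-injective)
open import Data.Fin.Subset using (Subset; inside; outside; _∩_; _─_; _-_; ∣_∣; Nonempty; _∈_; _⊆_) renaming (⊤ to full)
open import Data.Fin.Subset.Properties
  using (∈⊤; ∣⊤∣≡n; x∈p⇒∣p-x∣<∣p∣; x∈p∧x≢y⇒x∈p-y; p─q⊆p; ⊆-antisym; x∈p∩q⁻)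
open import Data.List using (List; []; _∷_; length; allFin; cartesianProduct)
open import Data.List.Membership.DecPropositional using (_∈?_)
open import Data.List.Membership.Propositional using () renaming (_∈_ to _∈ˡ_; _∉_ to _∉ˡ_)
open import Data.List.Membership.Propositional.Properties using (∈-cartesianProduct⁺; ∈-allFin)
open import Data.List.Relation.Unary.All using (All; []; _∷_)
import Data.List.Relation.Unary.All as All
open import Data.List.Relation.Unary.Any using (here; there)
open import Data.Maybe using (Maybe; just; nothing; fromMaybe)
import Data.Maybe as Maybe
open import Data.Maybe.Properties using (just-injective; ≡-dec)
open import Data.Nat using (ℕ; zero; suc; _≤_; _<_; z≤n; s≤s; _+_; _∸_; _⊔_; _≡ᵇ_)
import Data.Nat.Properties as ℕ
open import Data.Product using (Σ; ∃; _×_; _,_; proj₁; proj₂)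
open import Data.Sum using (_⊎_; inj₁; inj₂; [_,_]′)
open import Data.Unit using (⊤; tt)
open import Data.Vec using ([]; _∷_; tabulate; foldr′; here; there)
open import Data.Vec.Properties using (lookup∘tabulate; []=⇒lookup; lookup⇒[]=)
open import Relation.Binary.Construct.Closure.ReflexiveTransitive using (Star; ε; _◅_; _◅◅_; gmap; reverse)
open import Relation.Binary.Definitions using (tri<; tri≈; tri>)
open import Relation.Binary.PropositionalEquality
  using (_≡_; _≢_; refl; sym; trans; cong; cong₂; subst; ≢-sym)
open import Relation.Nullary using (¬_; Dec; yes; no)
open import Relation.Nullary.Decidable using (⌊_⌋; _×-dec_; _⊎-dec_; ¬?)

-- The arguments are arranged to end in a contradiction, so that membership in a Kempe chain and the
-- existence of colourings can be used classically; adjacency is Boolean, so conclusions about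
-- neighbours can still be stated positively. Two moves act on a colouring that leaves only the core
-- edge `r x` open, with `α` missing at `r` and `β` at `x`. A Kempe change on a chain of `α` and
-- another colour that avoids `r` keeps this situation. If a neighbour `w` of `x` misses `β`,
-- recolouring `x w` with `β` makes its old colour `γ` missing at both `x` and `w`. The fans at `r`
-- for `β` before and for `γ` after this both end at a vertex missing no colour, hence at the only
-- core neighbour of `r` besides `x`; so one of the two colours leads to the other. The obstacle is
-- a `w` not adjacent to `r`: no fan at `r` contains it, so it must be compared with the other
-- neighbours of `x` and of `r`. Core edges come before the edge `r s` because equal neighbourhoods
-- along core edges are what permits moving the hole from `r s` to a core edge at `r`.

¬¬∀Dec : ∀ {n} {P : Fin n → Set} → ((∀ i → Dec (P i)) → ⊥) → ⊥
¬¬∀Dec {zero} f = f λ ()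
¬¬∀Dec {suc n} {P} f = ¬¬∀Dec {n} {λ i → P (suc i)} λ d →
  let ¬p = λ p → f λ { zero → yes p ; (suc i) → d i }
  in f λ { zero → no ¬p ; (suc i) → d i }

-- Kempe changes

module Colourings (n k : ℕ) where

  V C : Set
  V = Fin n
  C = Fin k

  -- No graph occurs here, so Kempe changes and recolourings need no care about edges; `OneHole`
  -- ties a colouring to a graph afterwards.
  record PartialColouring : Set where
    field
      col : V → V → Maybe C
      colSym : ∀ u v → col u v ≡ col v u
      colProper : ∀ {u v w c} → col u v ≡ just c → col u w ≡ just c → v ≡ w
      colIrrefl : ∀ v → col v v ≡ nothing
  open PartialColouring public

  Miss : PartialColouring → V → C → Set
  Miss φ v c = ∀ w → col φ v w ≢ just c

  flip : ∀ φ {u v m} → col φ u v ≡ m → col φ v u ≡ m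
  flip φ {u} {v} e = trans (colSym φ v u) e

  same : ∀ {m : Maybe C} {c d} → m ≡ just c → m ≡ just d → c ≡ d
  same p q = just-injective (trans (sym p) q)

  Step : PartialColouring → C → C → V → V → Set
  Step φ a b u v = (col φ u v ≡ just a) ⊎ (col φ u v ≡ just b)

  Link : PartialColouring → C → C → V → V → Set
  Link φ a b = Star (Step φ a b)

  stepSym : ∀ φ {a b u v} → Step φ a b u v → Step φ a b v u
  stepSym φ (inj₁ p) = inj₁ (flip φ p)
  stepSym φ (inj₂ p) = inj₂ (flip φ p)

  linkSym : ∀ φ {a b u v} → Link φ a b u v → Link φ a b v u
  linkSym φ = reverse (stepSym φ)

  End : PartialColouring → C → C → V → Set
  End φ a b v = Miss φ v a ⊎ Miss φ v b

  -- From an endpoint the (a,b)-component is a single alternating path, and Walk v k e says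
  -- that this path reaches v after k steps, the next edge (if any) having colour e.
  module _ (φ : PartialColouring) {a b : C} (a≢b : a ≢ b) where

    other : C → C
    other e with e ≟ a
    ... | yes _ = b
    ... | no _ = a

    other-a : other a ≡ b
    other-a with a ≟ a
    ... | yes _ = refl
    ... | no q = ⊥-elim (q refl)

    other-b : other b ≡ a
    other-b with b ≟ a
    ... | yes q = ⊥-elim (a≢b (sym q))
    ... | no _ = refl

    module _ (u : V) (e₀ : C) (e₀ok : (e₀ ≡ a) ⊎ (e₀ ≡ b)) (miss : Miss φ u (other e₀)) where

      data Walk : V → ℕ → C → Set where
        start : Walk u 0 e₀
        next : ∀ {v w k e} → Walk v k e → col φ v w ≡ just e → Walk w (suc k) (other e)

      walkOk : ∀ {v k e} → Walk v k e → (e ≡ a) ⊎ (e ≡ b)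
      walkOk start = e₀ok
      walkOk (next W _) with walkOk W
      ... | inj₁ refl = inj₂ other-a
      ... | inj₂ refl = inj₁ other-b

      other² : ∀ {e} → (e ≡ a) ⊎ (e ≡ b) → other (other e) ≡ e
      other² (inj₁ refl) = trans (cong other other-a) other-b
      other² (inj₂ refl) = trans (cong other other-b) other-a

      det : ∀ {v w k e f} → Walk v k e → Walk w k f → v ≡ w × e ≡ f
      det start start = refl , refl
      det (next W p) (next W' q) with det W W'
      ... | refl , refl = colProper φ p q , refl

      reach : ∀ {v w} → (∃ λ k → ∃ λ e → Walk v k e) → Step φ a b v w → ∃ λ k → ∃ λ e → Walk w k e
      reach {v} {w} (k , e , W) s = go W (walkOk W) (stepCol s)
        where
        stepCol : Step φ a b v w → ∃ λ c → col φ v w ≡ just c × ((c ≡ a) ⊎ (c ≡ b))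
        stepCol (inj₁ p) = a , p , inj₁ refl
        stepCol (inj₂ p) = b , p , inj₂ refl
        dichot : ∀ {c e} → (c ≡ a) ⊎ (c ≡ b) → (e ≡ a) ⊎ (e ≡ b) → (c ≡ e) ⊎ (c ≡ other e)
        dichot (inj₁ refl) (inj₁ refl) = inj₁ refl
        dichot (inj₁ refl) (inj₂ refl) = inj₂ (sym other-b)
        dichot (inj₂ refl) (inj₁ refl) = inj₂ (sym other-a)
        dichot (inj₂ refl) (inj₂ refl) = inj₁ refl
        go : ∀ {k e} → Walk v k e → (e ≡ a) ⊎ (e ≡ b) → (∃ λ c → col φ v w ≡ just c × ((c ≡ a) ⊎ (c ≡ b)))
             → ∃ λ k → ∃ λ e → Walk w k e
        go {k} {e} W eok (c , p , cok) with dichot cok eok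
        ... | inj₁ refl = _ , _ , next W p
        go {zero} {e} start eok (c , p , cok) | inj₂ refl = ⊥-elim (miss w p)
        go {suc k} (next {v = v'} {e = e'} W q) eok (c , p , cok) | inj₂ refl =
          k , e' , subst (λ z → Walk z k e')
            (colProper φ (flip φ q) (subst (λ z → col φ v w ≡ just z) (other² (walkOk W)) p)) W

      reach* : ∀ {v w} → (∃ λ k → ∃ λ e → Walk v k e) → Link φ a b v w → ∃ λ k → ∃ λ e → Walk w k e
      reach* W ε = W
      reach* W (s ◅ L) = reach* (reach W s) L

      -- The walk enters `v` by the colour other than `e`, so of the two colours only `e` can be
      -- missing at `v`.
      stuck : ∀ {v k e} → Walk v k e → v ≢ u → End φ a b v → Miss φ v e
      stuck start q _ = ⊥-elim (q refl)
      stuck {v} (next {v = v'} {e = e'} W p) q end with walkOk W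
      stuck {v} (next {v = v'} W p) q (inj₁ m) | inj₁ refl = ⊥-elim (m v' (flip φ p))
      stuck {v} (next {v = v'} W p) q (inj₂ m) | inj₁ refl = subst (Miss φ v) (sym other-a) m
      stuck {v} (next {v = v'} W p) q (inj₁ m) | inj₂ refl = subst (Miss φ v) (sym other-b) m
      stuck {v} (next {v = v'} W p) q (inj₂ m) | inj₂ refl = ⊥-elim (m v' (flip φ p))

      -- Both are initial parts of one walk; if their lengths differed, the longer would leave the
      -- end of the shorter by the colour missing there.
      before : ∀ {v w j k e f} → Walk v j e → Walk w k f → v ≢ u → w ≢ u → End φ a b v → End φ a b w → v ≡ w
      before {v} {w} {j} {k} W X q q' m m' = cmp W X j k (stuck W q m) (stuck X q' m') refl refl
        where
        later : ∀ {v w j k e f} → Walk v j e → Walk w k f → suc j ≤ k → Miss φ v e → ⊥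
        later {k = suc k} {f = f} W (next {w = w} X p) (s≤s le) m with ℕ.<-cmp _ k
        ... | tri< lt _ _ = later W X lt m
        ... | tri≈ _ refl _ with det W X
        ...   | refl , refl = m w p
        later {k = suc k} W (next X p) (s≤s le) m | tri> _ _ gt =
          ℕ.<-irrefl refl (ℕ.≤-trans gt le)
        cmp : ∀ {v w j k e f} → Walk v j e → Walk w k f → ∀ j' k' → Miss φ v e → Miss φ w f → j ≡ j' → k ≡ k' → v ≡ w
        cmp {j = j} {k = k} W X _ _ m m' _ _ with ℕ.<-cmp j k
        ... | tri< lt _ _ = ⊥-elim (later W X lt m)
        ... | tri≈ _ refl _ = proj₁ (det W X)
        ... | tri> _ _ gt = ⊥-elim (later X W gt m')

    -- The walk from the end `u` covers its whole component and stops at the first other end. Most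
    -- contradictions below arise this way: once two ends of a chain are known, a third vertex
    -- missing one of its colours lies off the chain and can be changed separately.
    three : ∀ {u v w} → End φ a b u → End φ a b v → End φ a b w →
            Link φ a b u v → Link φ a b u w → v ≢ u → w ≢ u → v ≡ w
    three {u} (inj₁ m) ev ew L L' q q' =
      before u b (inj₂ refl) (subst (Miss φ u) (sym other-b) m) (proj₂ (proj₂ W)) (proj₂ (proj₂ X)) q q' ev ew
      where
      W = reach* u b (inj₂ refl) (subst (Miss φ u) (sym other-b) m) (0 , b , start) L
      X = reach* u b (inj₂ refl) (subst (Miss φ u) (sym other-b) m) (0 , b , start) L'
    three {u} (inj₂ m) ev ew L L' q q' =
      before u a (inj₁ refl) (subst (Miss φ u) (sym other-a) m) (proj₂ (proj₂ W)) (proj₂ (proj₂ X)) q q' ev ew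
      where
      W = reach* u a (inj₁ refl) (subst (Miss φ u) (sym other-a) m) (0 , a , start) L
      X = reach* u a (inj₁ refl) (subst (Miss φ u) (sym other-a) m) (0 , a , start) L'

  transpose : C → C → C → C
  transpose a b c with c ≟ a
  ... | yes _ = b
  ... | no _ with c ≟ b
  ...   | yes _ = a
  ...   | no _ = c

  transpose-a : ∀ a b → transpose a b a ≡ b
  transpose-a a b with a ≟ a
  ... | yes _ = refl
  ... | no q = ⊥-elim (q refl)

  transpose-b : ∀ a b → transpose a b b ≡ a
  transpose-b a b with b ≟ a
  ... | yes p = p
  ... | no _ with b ≟ b
  ...   | yes _ = refl
  ...   | no q = ⊥-elim (q refl)

  transpose-other : ∀ {a b c} → c ≢ a → c ≢ b → transpose a b c ≡ c
  transpose-other {a} {b} {c} p q with c ≟ a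
  ... | yes r = ⊥-elim (p r)
  ... | no _ with c ≟ b
  ...   | yes r = ⊥-elim (q r)
  ...   | no _ = refl

  transpose² : ∀ a b c → transpose a b (transpose a b c) ≡ c
  transpose² a b c with c ≟ a
  ... | yes refl = transpose-b a b
  ... | no p with c ≟ b
  ...   | yes refl = transpose-a a b
  ...   | no q = transpose-other p q

  -- A Kempe change is described by its effects, because constructing it needs a decision of chain
  -- membership that exists only under a double negation.
  record Swapped (φ ψ : PartialColouring) (a b : C) (u : V) : Set where
    field
      missIn : ∀ {v c} → Link φ a b u v → Miss φ v c → Miss ψ v (transpose a b c)
      colIn : ∀ {v w c} → Link φ a b u v → col φ v w ≡ just c → col ψ v w ≡ just (transpose a b c)
      colOut : ∀ {v} → ¬ Link φ a b u v → ∀ w → col ψ v w ≡ col φ v w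
      keepOther : ∀ {v w c} → c ≢ a → c ≢ b → col φ v w ≡ just c → col ψ v w ≡ just c
      keepOther⁻ : ∀ {v w c} → c ≢ a → c ≢ b → col ψ v w ≡ just c → col φ v w ≡ just c
      coloured⁻ : ∀ {v w c} → col ψ v w ≡ just c → ∃ λ d → col φ v w ≡ just d
      coloured⁺ : ∀ {v w c} → col φ v w ≡ just c → ∃ λ d → col ψ v w ≡ just d
      link⁻ : ∀ {v w} → Link ψ a b v w → Link φ a b v w

    outMiss : ∀ {v c} → ¬ Link φ a b u v → Miss φ v c → Miss ψ v c
    outMiss q m w e = m w (trans (sym (colOut q w)) e)

    missOther : ∀ {v c} → c ≢ a → c ≢ b → Miss φ v c → Miss ψ v c
    missOther p q m w e = m w (keepOther⁻ p q e)

    missA : ∀ {v} → Link φ a b u v → Miss φ v a → Miss ψ v b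
    missA {v} L m = subst (Miss ψ v) (transpose-a a b) (missIn L m)

    missB : ∀ {v} → Link φ a b u v → Miss φ v b → Miss ψ v a
    missB {v} L m = subst (Miss ψ v) (transpose-b a b) (missIn L m)

  module _ (φ : PartialColouring) {a b : C} (u : V) (d : ∀ v → Dec (Link φ a b u v)) where

    swapAt : V → Maybe C → Maybe C
    swapAt v m with d v
    ... | yes _ = Maybe.map (transpose a b) m
    ... | no _ = m

    swapAt-yes : ∀ {v m} → Link φ a b u v → swapAt v m ≡ Maybe.map (transpose a b) m
    swapAt-yes {v} L with d v
    ... | yes _ = refl
    ... | no q = ⊥-elim (q L)

    swapAt-no : ∀ {v m} → ¬ Link φ a b u v → swapAt v m ≡ m
    swapAt-no {v} q with d v
    ... | yes L = ⊥-elim (q L)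
    ... | no _ = refl

    swapAt-other : ∀ {v m c} → c ≢ a → c ≢ b → m ≡ just c → swapAt v m ≡ just c
    swapAt-other {v} p q refl with d v
    ... | yes _ = cong just (transpose-other p q)
    ... | no _ = refl

    swapAt-inv : ∀ {v m c} → swapAt v m ≡ just c → m ≡ just c ⊎ m ≡ just (transpose a b c)
    swapAt-inv {v} {m} {c} e with d v
    swapAt-inv {v} {just x} {c} refl | yes _ = inj₂ (cong just (sym (transpose² a b x)))
    ... | no _ = inj₁ e

    swapped : PartialColouring
    swapped .col v w = swapAt v (col φ v w)
    swapped .colSym v w with col φ v w in eq | colSym φ v w
    ... | nothing | q rewrite sym q with d v | d w
    ...   | yes _ | yes _ = refl
    ...   | yes _ | no _ = refl
    ...   | no _ | yes _ = refl
    ...   | no _ | no _ = refl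
    swapped .colSym v w | just c | q rewrite sym q with d v | d w
    ... | yes _ | yes _ = refl
    ... | no _ | no _ = refl
    -- An edge that leaves the component has neither of the two colours, so transposing at only one
    -- of its ends changes nothing.
    ... | yes L | no ¬L = cong just (transpose-other (λ { refl → ¬L (L ◅◅ (inj₁ eq ◅ ε)) }) (λ { refl → ¬L (L ◅◅ (inj₂ eq ◅ ε)) }))
    ... | no ¬L | yes L = cong just (sym (transpose-other (λ { refl → ¬L (L ◅◅ (inj₁ (flip φ eq) ◅ ε)) }) (λ { refl → ¬L (L ◅◅ (inj₂ (flip φ eq) ◅ ε)) })))
    swapped .colProper {v} {w} {x} {c} p q with d v
    ... | no _ = colProper φ p q
    ... | yes _ with col φ v w in e | col φ v x in e'
    swapped .colProper {v} {w} {x} {c} refl q | yes _ | just y | just z =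
      colProper φ e (trans e' (cong just (trans (sym (transpose² a b z)) (trans (cong (transpose a b) (just-injective q)) (transpose² a b y)))))
    swapped .colIrrefl v with d v
    ... | yes _ rewrite colIrrefl φ v = refl
    ... | no _ = colIrrefl φ v

    back : ∀ {v w} → col swapped v w ≡ just a ⊎ col swapped v w ≡ just b → Step φ a b v w
    back (inj₁ e) with swapAt-inv e
    ... | inj₁ p = inj₁ p
    ... | inj₂ p = inj₂ (trans p (cong just (transpose-a a b)))
    back (inj₂ e) with swapAt-inv e
    ... | inj₁ p = inj₂ p
    ... | inj₂ p = inj₁ (trans p (cong just (transpose-b a b)))

    swappedSpec : Swapped φ swapped a b u
    swappedSpec = record
      { missIn = λ {v} {c} L m w e → m w (inn' v c L w e)
      ; colIn = λ {v} L e → trans (swapAt-yes L) (cong (Maybe.map (transpose a b)) e)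
      ; colOut = λ q w → swapAt-no q
      ; keepOther = λ p q e → swapAt-other p q e
      ; keepOther⁻ = λ p q e → [ (λ z → z) , (λ z → trans z (cong just (transpose-other p q))) ]′ (swapAt-inv e)
      ; coloured⁻ = λ e → [ (λ z → _ , z) , (λ z → _ , z) ]′ (swapAt-inv e)
      ; coloured⁺ = λ {v} {w} e → fj' v w e
      ; link⁻ = gmap (λ z → z) back
      }
      where
      inn' : ∀ v c → Link φ a b u v → ∀ w → col swapped v w ≡ just (transpose a b c) → col φ v w ≡ just c
      inn' v c L w e with trans (sym (swapAt-yes {v} {col φ v w} L)) e
      ... | e' with col φ v w
      inn' v c L w e | e' | just x = cong just (trans (sym (transpose² a b x)) (trans (cong (transpose a b) (just-injective e')) (transpose² a b c)))
      fj' : ∀ v w {c} → col φ v w ≡ just c → ∃ λ d → col swapped v w ≡ just d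
      fj' v w e with d v
      ... | yes _ rewrite e = _ , refl
      ... | no _ = _ , e

  -- Membership in a component is not decided; for the goal ⊥ its decidability may be assumed.
  swapComponent : ∀ φ a b u → (∀ ψ → Swapped φ ψ a b u → ⊥) → ⊥
  swapComponent φ a b u f = ¬¬∀Dec λ d → f (swapped φ u d) (swappedSpec φ u d)

-- Recolouring along fans

module Moves (n k : ℕ) where
  open Colourings n k public

  Edge? : (p q u v : V) → Dec ((u ≡ p × v ≡ q) ⊎ (u ≡ q × v ≡ p))
  Edge? p q u v = ((u ≟ p) ×-dec (v ≟ q)) ⊎-dec ((u ≟ q) ×-dec (v ≟ p))

  record Recoloured (φ ψ : PartialColouring) (p q : V) (m : Maybe C) : Set where
    field
      new : col ψ p q ≡ m
      old : ∀ {u v} → ¬ ((u ≡ p × v ≡ q) ⊎ (u ≡ q × v ≡ p)) → col ψ u v ≡ col φ u v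

    away : ∀ {u} → u ≢ p → u ≢ q → ∀ w → col ψ u w ≡ col φ u w
    away a b w = old λ { (inj₁ (x , _)) → a x ; (inj₂ (x , _)) → b x }

    awayMiss : ∀ {u c} → u ≢ p → u ≢ q → Miss φ u c → Miss ψ u c
    awayMiss a b m w e = m w (trans (sym (away a b w)) e)

    atP : p ≢ q → ∀ {w} → w ≢ q → col ψ p w ≡ col φ p w
    atP pq a = old λ { (inj₁ (_ , x)) → a x ; (inj₂ (x , _)) → pq x }

    missP : p ≢ q → ∀ {c} → Miss φ p c → m ≢ just c → Miss ψ p c
    missP pq {c} mi ne w e with w ≟ q
    ... | yes refl = ne (trans (sym new) e)
    ... | no a = mi w (trans (sym (atP pq a)) e)

    gainP : p ≢ q → ∀ {c} → col φ p q ≡ just c → m ≢ just c → Miss ψ p c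
    gainP pq {c} ec ne w e with w ≟ q
    ... | yes refl = ne (trans (sym new) e)
    ... | no a = a (colProper φ (trans (sym (atP pq a)) e) ec)

  recolouredSym : ∀ {φ ψ p q m} → Recoloured φ ψ p q m → Recoloured φ ψ q p m
  recolouredSym {φ} {ψ} U = record
    { new = flip ψ (Recoloured.new U)
    ; old = λ ne → Recoloured.old U λ { (inj₁ x) → ne (inj₂ x) ; (inj₂ x) → ne (inj₁ x) } }

  module _ (φ : PartialColouring) {p q : V} (p≢q : p ≢ q) (m : Maybe C)
           (mp : ∀ c → m ≡ just c → Miss φ p c) (mq : ∀ c → m ≡ just c → Miss φ q c) where

    recolourAt : V → V → Maybe C
    recolourAt u v with Edge? p q u v
    ... | yes _ = m
    ... | no _ = col φ u v

    recolour-new : ∀ {u v} → (u ≡ p × v ≡ q) ⊎ (u ≡ q × v ≡ p) → recolourAt u v ≡ m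
    recolour-new {u} {v} e with Edge? p q u v
    ... | yes _ = refl
    ... | no ne = ⊥-elim (ne e)

    recolour-old : ∀ {u v} → ¬ ((u ≡ p × v ≡ q) ⊎ (u ≡ q × v ≡ p)) → recolourAt u v ≡ col φ u v
    recolour-old {u} {v} e with Edge? p q u v
    ... | yes ne = ⊥-elim (e ne)
    ... | no _ = refl

    turn : ∀ {u v} → (u ≡ p × v ≡ q) ⊎ (u ≡ q × v ≡ p) → (v ≡ p × u ≡ q) ⊎ (v ≡ q × u ≡ p)
    turn (inj₁ (a , b)) = inj₂ (b , a)
    turn (inj₂ (a , b)) = inj₁ (b , a)

    missEither : ∀ {u v c} → (u ≡ p × v ≡ q) ⊎ (u ≡ q × v ≡ p) → m ≡ just c → Miss φ u c
    missEither (inj₁ (refl , _)) e = mp _ e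
    missEither (inj₂ (refl , _)) e = mq _ e

    recoloured : PartialColouring
    recoloured .col = recolourAt
    recoloured .colSym u v with Edge? p q u v
    ... | yes e = sym (recolour-new (turn e))
    ... | no ne = trans (colSym φ u v) (sym (recolour-old λ e → ne (turn e)))
    recoloured .colProper {u} {v} {w} {c} a b with Edge? p q u v | Edge? p q u w
    ... | yes (inj₁ (refl , refl)) | yes (inj₁ (_ , refl)) = refl
    ... | yes (inj₁ (refl , refl)) | yes (inj₂ (x , _)) = ⊥-elim (p≢q x)
    ... | yes (inj₂ (refl , refl)) | yes (inj₁ (x , _)) = ⊥-elim (p≢q (sym x))
    ... | yes (inj₂ (refl , refl)) | yes (inj₂ (_ , refl)) = refl
    ... | yes e | no _ = ⊥-elim (missEither e a w b)
    ... | no _ | yes e = ⊥-elim (missEither e b v a)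
    ... | no _ | no _ = colProper φ a b
    recoloured .colIrrefl u with Edge? p q u u
    ... | yes (inj₁ (x , y)) = ⊥-elim (p≢q (trans (sym x) y))
    ... | yes (inj₂ (x , y)) = ⊥-elim (p≢q (trans (sym y) x))
    ... | no _ = colIrrefl φ u

    recolouredSpec : Recoloured φ recoloured p q m
    recolouredSpec = record { new = recolour-new (inj₁ (refl , refl)) ; old = recolour-old }

  recolourEdge : ∀ φ {p q c} → p ≢ q → Miss φ p c → Miss φ q c → ∃ λ ψ → Recoloured φ ψ p q (just c)
  recolourEdge φ {c = c} ne mp mq = _ , recolouredSpec φ ne (just c) (λ { _ refl → mp }) (λ { _ refl → mq })

  uncolourEdge : ∀ φ {p q} → p ≢ q → ∃ λ ψ → Recoloured φ ψ p q nothing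
  uncolourEdge φ ne = _ , recolouredSpec φ ne nothing (λ _ ()) (λ _ ())

  coloured⇒≢ : ∀ φ {u v c} → col φ u v ≡ just c → u ≢ v
  coloured⇒≢ φ {u} e refl with trans (sym (colIrrefl φ u)) e
  ... | ()

  Miss? : ∀ φ v c → Dec (Miss φ v c)
  Miss? φ v c = all? λ w → ¬? (≡-dec _≟_ (col φ v w) (just c))

  present : ∀ φ v c → ¬ Miss φ v c → ∃ λ w → col φ v w ≡ just c
  present φ v c q with any? (λ w → ≡-dec _≟_ (col φ v w) (just c))
  ... | yes p = p
  ... | no np = ⊥-elim (q λ w e → np (w , e))

  -- FanPath φ r Q c d: the fan at r that starts with the colour c arrives at the colour d; every
  -- fan vertex v that hands over the missing colour e satisfies Q v e.
  data FanPath (φ : PartialColouring) (r : V) (Q : V → C → Set) (c : C) : C → Set where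
    nil : FanPath φ r Q c c
    snoc : ∀ {d e} → FanPath φ r Q c d → ∀ v → col φ r v ≡ just d → Miss φ v e → Q v e → FanPath φ r Q c e

  Any : V → C → Set
  Any _ _ = ⊤

  FreeFanPath : PartialColouring → V → C → C → Set
  FreeFanPath φ r = FanPath φ r Any

  mapPath : ∀ {φ ψ r Q Q' c d} →
    (∀ {d v e} → FanPath φ r Q c d → col φ r v ≡ just d → Miss φ v e → Q v e →
       col ψ r v ≡ just d × Miss ψ v e × Q' v e) →
    FanPath φ r Q c d → FanPath ψ r Q' c d
  mapPath f nil = nil
  mapPath f (snoc L v p m q) with f L p m q
  ... | p' , m' , q' = snoc (mapPath f L) v p' m' q'

  forget : ∀ {φ r Q c d} → FanPath φ r Q c d → FreeFanPath φ r c d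
  forget = mapPath λ _ p m _ → p , m , tt

  concatPath : ∀ {φ r Q c d e} → FanPath φ r Q c d → FanPath φ r Q d e → FanPath φ r Q c e
  concatPath L nil = L
  concatPath L (snoc M v p m q) = snoc (concatPath L M) v p m q

  uncons : ∀ {φ r Q c e} → FanPath φ r Q c e →
    c ≡ e ⊎ ∃ λ v → ∃ λ d → col φ r v ≡ just c × Miss φ v d × Q v d × FanPath φ r Q d e
  uncons nil = inj₁ refl
  uncons (snoc L v p m q) with uncons L
  ... | inj₁ refl = inj₂ (v , _ , p , m , q , nil)
  ... | inj₂ (v' , d , p' , m' , q' , M) = inj₂ (v' , d , p' , m' , q' , snoc M v p m q)

  -- Only colours handed over by a fan vertex are tested, not the starting colour `c`; an empty path
  -- therefore remains as a separate case for the users.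
  first : ∀ {φ r Q c d} {P : C → Set} → (∀ e → Dec (P e)) → FanPath φ r Q c d →
    FanPath φ r (λ v e → Q v e × ¬ P e) c d ⊎
    (∃ λ f → ∃ λ v → ∃ λ e → FanPath φ r (λ v e → Q v e × ¬ P e) c f × col φ r v ≡ just f × Miss φ v e × Q v e × P e)
  first P? nil = inj₁ nil
  first P? (snoc {e = e} L v p m q) with first P? L
  ... | inj₂ x = inj₂ x
  ... | inj₁ L' with P? e
  ...   | yes y = inj₂ (_ , v , e , L' , p , m , q , y)
  ...   | no y = inj₁ (snoc L' v p m (q , y))

  pathLength : ∀ {φ r Q c d} → FanPath φ r Q c d → ℕ
  pathLength nil = 0
  pathLength (snoc L _ _ _ _) = suc (pathLength L)

  -- A path may run through `v` more than once. Recolouring `r v` breaks it there, but the part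
  -- before the first visit survives and arrives at the old colour `d`. The bound on the length
  -- drives the recursion in `unwindBy`.
  truncate : ∀ {φ ψ r v d m Q c e} → Recoloured φ ψ r v m → col φ r v ≡ just d → (L : FanPath φ r Q c e) →
    (Σ (FanPath ψ r Q c e) λ M → pathLength M ≤ pathLength L) ⊎ (Σ (FanPath ψ r Q c d) λ M → pathLength M ≤ pathLength L)
  truncate U p nil = inj₁ (nil , z≤n)
  truncate {φ} {ψ} {r} {v} U p (snoc L u q m x) with truncate U p L
  ... | inj₂ (M , le) = inj₂ (M , ℕ.m≤n⇒m≤1+n le)
  ... | inj₁ (M , le) with u ≟ v
  ...   | yes refl rewrite same {c = _} q p = inj₂ (M , ℕ.m≤n⇒m≤1+n le)
  ...   | no ne = inj₁ (snoc M u (trans (Recoloured.atP U (coloured⇒≢ φ p) ne) q)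
                    (Recoloured.awayMiss U (λ { refl → coloured⇒≢ φ q refl }) ne m) x , s≤s le)

  -- The predicate `R` confines the changes: an edge at `r` whose colour is known to be off the fan
  -- keeps it, and a colour missing at `r` and off the fan stays missing.
  record Unwound (φ : PartialColouring) (r : V) (R : C → Set) (c : C) (ψ : PartialColouring) : Set where
    field
      miss : Miss ψ r c
      colOut : ∀ {u w} → u ≢ r → w ≢ r → col ψ u w ≡ col φ u w
      chg : ∀ u → col ψ r u ≡ col φ r u ⊎ ∃ λ f → R f × col φ r u ≡ just f
      coloured⁺ : ∀ {u c} → col φ r u ≡ just c → ∃ λ d → col ψ r u ≡ just d
      keep : ∀ {d} → Miss φ r d → Miss ψ r d ⊎ R d

    outMiss : ∀ {u e} → u ≢ r → col ψ r u ≡ col φ r u → Miss φ u e → Miss ψ u e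
    outMiss {u} ne same' m w e with w ≟ r
    ... | yes refl = m w (trans (colSym φ u w) (trans (sym same') (flip ψ e)))
    ... | no nw = m w (trans (sym (colOut ne nw)) e)

    non : ∀ {u} → col φ r u ≡ nothing → col ψ r u ≡ col φ r u
    non {u} e with chg u
    ... | inj₁ p = p
    ... | inj₂ (f , _ , p) with trans (sym e) p
    ...   | ()

  -- Recolouring the fan backwards, starting from its last vertex, which misses a colour missing at r.
  unwindBy : ∀ N {φ r R c a} → Miss φ r a → R c → (L : FanPath φ r (λ _ e → R e) c a) → pathLength L ≤ N →
         ∃ (Unwound φ r R c)
  unwindBy _ {φ} m Rc nil le = φ , record { miss = m ; colOut = λ _ _ → refl ; chg = λ _ → inj₁ refl ; coloured⁺ = λ p → _ , p ; keep = inj₁ }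
  unwindBy (suc N) {φ} {r} {R} {c} {a} m Rc (snoc {d = d} L v p mv Ra) (s≤s le) with recolourEdge φ (coloured⇒≢ φ p) m mv
  ... | φ₁ , U = go (unwindBy N (Recoloured.gainP U ne p (λ { refl → mv r (flip φ p) })) Rc (proj₁ tail) (ℕ.≤-trans (proj₂ tail) le))
    where
    ne = coloured⇒≢ φ p
    tail : Σ (FanPath φ₁ r (λ _ e → R e) c d) λ M → pathLength M ≤ pathLength L
    tail with truncate U p L
    ... | inj₁ x = x
    ... | inj₂ x = x
    Rd : R d
    Rd = last L
      where
      last : ∀ {d} → FanPath φ r (λ _ e → R e) c d → R d
      last nil = Rc
      last (snoc _ _ _ _ x) = x
    go : ∃ (Unwound φ₁ r R c) → ∃ (Unwound φ r R c)
    go (ψ , D) = ψ , record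
      { miss = Unwound.miss D
      ; colOut = λ {u} {w} a b → trans (Unwound.colOut D a b) (Recoloured.old U λ { (inj₁ (x , _)) → a x ; (inj₂ (_ , x)) → b x })
      ; chg = chg'
      ; coloured⁺ = fj'
      ; keep = keep' }
      where
      chg' : ∀ u → col ψ r u ≡ col φ r u ⊎ ∃ λ f → R f × col φ r u ≡ just f
      chg' u with u ≟ v
      ... | yes refl = inj₂ (d , Rd , p)
      ... | no nu with Unwound.chg D u
      ...   | inj₁ e = inj₁ (trans e (Recoloured.atP U ne nu))
      ...   | inj₂ (f , Rf , e) = inj₂ (f , Rf , trans (sym (Recoloured.atP U ne nu)) e)
      fj' : ∀ {u c} → col φ r u ≡ just c → ∃ λ d → col ψ r u ≡ just d
      fj' {u} e with u ≟ v
      ... | yes refl = Unwound.coloured⁺ D (Recoloured.new U)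
      ... | no nu = Unwound.coloured⁺ D (trans (Recoloured.atP U ne nu) e)
      keep' : ∀ {e} → Miss φ r e → Miss ψ r e ⊎ R e
      keep' {e} me with e ≟ a
      ... | yes refl = inj₂ Ra
      ... | no ea = Unwound.keep D (Recoloured.missP U ne me (λ { refl → ea refl }))

  -- With `R` chosen as the colours at which the fan from `c` arrives, any edge that was changed is
  -- itself an edge of the fan.
  unwindAll : ∀ {φ r Q c a} → Miss φ r a → FanPath φ r Q c a → ∃ (Unwound φ r (FanPath φ r Q c) c)
  unwindAll {φ} {r} {Q} {c} m L = unwindBy (pathLength M) m nil M ℕ.≤-refl
    where
    M = mapPath (λ L p m q → p , m , snoc L _ p m q) L

  unwound⁻ : ∀ {φ ψ s R c} → Unwound φ s R c ψ → ∀ {u v e} → col ψ u v ≡ just e → ∃ λ d → col φ u v ≡ just d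
  unwound⁻ {φ} {ψ} {s} D {u} {v} x with u ≟ s | v ≟ s
  ... | yes refl | _ = at v x
    where
    at : ∀ u {c} → col ψ s u ≡ just c → ∃ λ d → col φ s u ≡ just d
    at u x with Unwound.chg D u
    ... | inj₁ e = _ , trans (sym e) x
    ... | inj₂ (_ , _ , e) = _ , e
  ... | no _ | yes refl with Unwound.chg D u
  ...   | inj₁ e = _ , flip φ (trans (sym e) (flip ψ x))
  ...   | inj₂ (_ , _ , e) = _ , flip φ e
  unwound⁻ D x | no p | no q = _ , trans (sym (Unwound.colOut D p q)) x

  unwound⁺ : ∀ {φ ψ s R c} → Unwound φ s R c ψ → ∀ {u v e} → col φ u v ≡ just e → ∃ λ d → col ψ u v ≡ just d
  unwound⁺ {φ} {ψ} {s} D {u} {v} x with u ≟ s | v ≟ s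
  ... | yes refl | _ = Unwound.coloured⁺ D x
  ... | no _ | yes refl = _ , flip ψ (proj₂ (Unwound.coloured⁺ D (flip φ x)))
  ... | no p | no q = _ , trans (Unwound.colOut D p q) x

  -- Colourings with one uncoloured edge, and Vizing fans

  module Graph (G : SimpleGraph n) where
    open SimpleGraph G using (adj; irrefl) renaming (sym to asym)

    record OneHole (φ : PartialColouring) (r z : V) : Set where
      field
        edge : adj r z ≡ true
        on : ∀ {u v c} → col φ u v ≡ just c → adj u v ≡ true
        cov : ∀ {u v} → adj u v ≡ true → ((u ≡ r × v ≡ z) ⊎ (u ≡ z × v ≡ r)) ⊎ ∃ λ c → col φ u v ≡ just c
        hole : col φ r z ≡ nothing

      r≢z : r ≢ z
      r≢z refl with trans (sym edge) (irrefl r)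
      ... | ()

    NonCol : Set
    NonCol = ∀ φ → (∀ {u v c} → col φ u v ≡ just c → adj u v ≡ true) →
             (∀ {u v} → adj u v ≡ true → ∃ λ c → col φ u v ≡ just c) → ⊥

    holeSym : ∀ {φ r z} → OneHole φ r z → OneHole φ z r
    holeSym {φ} {r} {z} S = record
      { edge = trans (asym z r) (OneHole.edge S) ; on = OneHole.on S
      ; cov = λ a → [ (λ { (inj₁ x) → inj₁ (inj₂ x) ; (inj₂ x) → inj₁ (inj₁ x) }) , inj₂ ]′ (OneHole.cov S a)
      ; hole = flip φ (OneHole.hole S) }

    holeMap : ∀ {φ ψ r z} → (∀ {u v c} → col ψ u v ≡ just c → ∃ λ d → col φ u v ≡ just d) →
            (∀ {u v c} → col φ u v ≡ just c → ∃ λ d → col ψ u v ≡ just d) → OneHole φ r z → OneHole ψ r z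
    holeMap {φ} {ψ} {r} {z} b f S = record
      { edge = OneHole.edge S ; on = λ p → OneHole.on S (proj₂ (b p))
      ; cov = λ a → [ inj₁ , (λ { (_ , p) → inj₂ (f p) }) ]′ (OneHole.cov S a)
      ; hole = h }
      where
      h : col ψ r z ≡ nothing
      h with col ψ r z in eq
      ... | nothing = refl
      ... | just c with trans (sym (OneHole.hole S)) (proj₂ (b eq))
      ...   | ()

    holeSwapped : ∀ {φ ψ a b u r z} → Swapped φ ψ a b u → OneHole φ r z → OneHole ψ r z
    holeSwapped K = holeMap (Swapped.coloured⁻ K) (Swapped.coloured⁺ K)

    holeRecoloured : ∀ {φ ψ p q c d r z} → Recoloured φ ψ p q (just c) → col φ p q ≡ just d → OneHole φ r z → OneHole ψ r z
    holeRecoloured {φ} {ψ} {p} {q} {c} {d} U e = holeMap b f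
      where
      b : ∀ {u v c} → col ψ u v ≡ just c → ∃ λ d → col φ u v ≡ just d
      b {u} {v} x with Edge? p q u v
      ... | yes (inj₁ (refl , refl)) = _ , e
      ... | yes (inj₂ (refl , refl)) = _ , flip φ e
      ... | no ne = _ , trans (sym (Recoloured.old U ne)) x
      f : ∀ {u v c} → col φ u v ≡ just c → ∃ λ d → col ψ u v ≡ just d
      f {u} {v} x with Edge? p q u v
      ... | yes (inj₁ (refl , refl)) = _ , Recoloured.new U
      ... | yes (inj₂ (refl , refl)) = _ , flip ψ (Recoloured.new U)
      ... | no ne = _ , trans (Recoloured.old U ne) x

    holeUnwound : ∀ {φ ψ s R c r z} → Unwound φ s R c ψ → OneHole φ r z → OneHole ψ r z
    holeUnwound D = holeMap (unwound⁻ D) (unwound⁺ D)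

    module _ (nc : NonCol) where

      clash : ∀ {φ r z c} → OneHole φ r z → Miss φ r c → Miss φ z c → ⊥
      clash {φ} {r} {z} S missR mz with recolourEdge φ (OneHole.r≢z S) missR mz
      ... | ψ , U = nc ψ on' cov'
        where
        on' : ∀ {u v c} → col ψ u v ≡ just c → adj u v ≡ true
        on' {u} {v} x with Edge? r z u v
        ... | yes (inj₁ (refl , refl)) = OneHole.edge S
        ... | yes (inj₂ (refl , refl)) = trans (asym z r) (OneHole.edge S)
        ... | no ne = OneHole.on S (trans (sym (Recoloured.old U ne)) x)
        cov' : ∀ {u v} → adj u v ≡ true → ∃ λ c → col ψ u v ≡ just c
        cov' {u} {v} a with Edge? r z u v
        ... | yes (inj₁ (refl , refl)) = _ , Recoloured.new U
        ... | yes (inj₂ (refl , refl)) = _ , flip ψ (Recoloured.new U)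
        ... | no ne with OneHole.cov S a
        ...   | inj₁ x = ⊥-elim (ne x)
        ...   | inj₂ (c , x) = c , trans (Recoloured.old U ne) x

      -- Vizing's argument: unwinding the fan makes `r` miss `c`, which `z` misses already.
      noPath : ∀ {φ r z Q c a} → OneHole φ r z → Miss φ z c → Miss φ r a → FanPath φ r Q c a → ⊥
      noPath {φ} {r} {z} S mz missR L with unwindAll missR L
      ... | ψ , D = clash (holeUnwound D S) (Unwound.miss D)
        (Unwound.outMiss D (≢-sym (OneHole.r≢z S)) (Unwound.non D (OneHole.hole S)) mz)

      -- Otherwise the change at `z` would make `z` miss `a` while `r` still misses it.
      holeLinked : ∀ {φ r z a c} → OneHole φ r z → Miss φ r a → Miss φ z c → ¬ Link φ a c r z → ⊥
      holeLinked {φ} {r} {z} {a} {c} S missR mz nl = swapComponent φ a c z λ ψ K →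
        clash (holeSwapped K S) (Swapped.outMiss K (λ L → nl (linkSym φ L)) missR) (Swapped.missB K ε mz)

      record Reached (φ : PartialColouring) (r : V) (c : C) (v : V) (e : C) : Set where
        constructor reached
        field
          {last} : C
          lead : FreeFanPath φ r c last
          arc : col φ r v ≡ just last
          gap : Miss φ v e

      extend : ∀ {φ r c v e} → Reached φ r c v e → FreeFanPath φ r c e
      extend (reached L p m) = snoc L _ p m tt

      -- Since `r` is off the changed chain, the edges of the fan keep their colours. A fan vertex
      -- that missed `e` can at worst miss `a` instead, and then the fan arrives at `a` even
      -- earlier.
      swapPathOrHit : ∀ {φ ψ r a e v c d Q} → (∀ {v x y} → Q v x → Q v y) → Swapped φ ψ a e v → ¬ Link φ a e v r →
                 (FanPath φ r Q c a → ⊥) → FanPath φ r Q c d → FanPath ψ r Q c d ⊎ FanPath ψ r Q c a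
      swapPathOrHit qq K nl na nil = inj₁ nil
      swapPathOrHit {φ} {ψ} {r} {a} {e} {v} {c} {Q = Q} qq K nl na (snoc {e = x} L u p m q) with swapPathOrHit qq K nl na L
      ... | inj₂ M = inj₂ M
      ... | inj₁ M with x ≟ a
      ...   | yes refl = ⊥-elim (na (snoc L u p m q))
      ...   | no xa with x ≟ e
      ...     | no xe = inj₁ (snoc M u (trans (Swapped.colOut K nl u) p) (Swapped.missOther K xa xe m) q)
      ...     | yes refl with Miss? ψ u e
      ...       | yes y = inj₁ (snoc M u (trans (Swapped.colOut K nl u) p) y q)
      ...       | no ny with Miss? ψ u a
      ...         | yes y = inj₂ (snoc M u (trans (Swapped.colOut K nl u) p) y (qq q))
      ...         | no na' = ⊥-elim (ny (Swapped.outMiss K (λ l → na' (Swapped.missB K l m)) m))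

      module Fan {φ : PartialColouring} {r z : V} {a c : C} (S : OneHole φ r z) (missR : Miss φ r a) (mz : Miss φ z c) where

        a≢c : a ≢ c
        a≢c refl = clash S missR mz

        noA : ∀ {Q} → FanPath φ r Q c a → ⊥
        noA = noPath S mz missR

        -- If not, the change at `v` makes `v` miss `a`, and the fan from `c` arrives at a colour
        -- missing at `r`.
        fanLink : ∀ {v e} → Reached φ r c v e → ¬ ¬ Link φ a e r v
        fanLink {v} {e} (reached L p m) nl = holeLinked S missR mz λ Lrz → swapComponent φ a e v λ ψ K →
          noPath (holeSwapped K S) (keepZ K Lrz (c ≟ e)) (Swapped.outMiss K (λ l → nl (linkSym φ l)) missR)
            ([ (λ M → snoc M v (trans (Swapped.colOut K (λ l → nl (linkSym φ l)) v) p) (Swapped.missB K ε m) tt) , (λ M → M) ]′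
               (swapPathOrHit (λ _ → tt) K (λ l → nl (linkSym φ l)) noA L))
          where
          keepZ : ∀ {ψ} → Swapped φ ψ a e v → Link φ a c r z → Dec (c ≡ e) → Miss ψ z c
          -- For `c` equal to `e` the vertex `z` is safe because it lies on the chain of `r`, which
          -- is not the one being changed.
          keepZ K Lrz (yes refl) = Swapped.outMiss K (λ l → nl (Lrz ◅◅ linkSym φ l)) mz
          keepZ K Lrz (no ne) = Swapped.missOther K (λ x → a≢c (sym x)) ne mz

        -- Both vertices would be ends of the chain that starts at `r`.
        fanElem : ∀ {v v' e} → Reached φ r c v e → Reached φ r c v' e → v ≢ v' → ⊥
        fanElem {v} {v'} {e} R R' ne with a ≟ e
        ... | yes refl = noA (extend R)
        ... | no ae = fanLink R λ L → fanLink R' λ L' →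
          ne (three φ ae (inj₁ missR) (inj₂ (Reached.gap R)) (inj₂ (Reached.gap R')) L L'
            (λ { refl → coloured⇒≢ φ (Reached.arc R) refl }) (λ { refl → coloured⇒≢ φ (Reached.arc R') refl }))

        fanHole : ∀ {v e} → Reached φ r c v e → Miss φ z e → ⊥
        fanHole {v} {e} R mze = fanLink R λ L → holeLinked S missR mze λ L' →
          off (three φ (λ { refl → clash S missR mze }) (inj₁ missR) (inj₂ (Reached.gap R)) (inj₂ mze) L L'
            (λ { refl → coloured⇒≢ φ (Reached.arc R) refl }) (λ x → OneHole.r≢z S (sym x)))
          where
          off : v ≢ z
          off refl with trans (sym (OneHole.hole S)) (Reached.arc R)
          ... | ()

        data Path : List C → C → Set where
          base : Path [] c
          ext : ∀ {vs d e} → Path vs d → ∀ v → col φ r v ≡ just d → Miss φ v e → e ∉ˡ d ∷ vs → Path (d ∷ vs) e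

        pathLead : ∀ {vs d} → Path vs d → FreeFanPath φ r c d
        pathLead base = nil
        pathLead (ext P v p m _) = snoc (pathLead P) v p m tt

        fresh : ∀ {vs d} → Path vs d → d ∉ˡ vs
        fresh base ()
        fresh (ext P v p m q) = q

        old : ∀ {vs d e} → Path vs d → e ∈ˡ d ∷ vs →
          e ≡ c ⊎ ∃ λ v → ∃ λ f → FreeFanPath φ r c f × col φ r v ≡ just f × Miss φ v e × f ∈ˡ vs
        old base (here refl) = inj₁ refl
        old (ext P v p m q) (here refl) = inj₂ (v , _ , pathLead P , p , m , here refl)
        old (ext P v p m q) (there i) with old P i
        ... | inj₁ x = inj₁ x
        ... | inj₂ (v' , f , L , p' , m' , j) = inj₂ (v' , f , L , p' , m' , there j)

        pathEnd : (∀ y d → FreeFanPath φ r c d → col φ r y ≡ just d → (∀ e → ¬ Miss φ y e) → ⊥) → ⊥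
        pathEnd f = go k full (ℕ.≤-reflexive (∣⊤∣≡n k)) base (λ _ _ → ∈⊤)
          where
          go : ∀ N (rem : Subset k) → ∣ rem ∣ ≤ N → ∀ {vs d} → Path vs d →
               (∀ e → e ∉ˡ d ∷ vs → e ∈ rem) → ⊥
          go N rem le {vs} {d} P inv with Miss? φ r d
          ... | yes y = noPath S mz y (pathLead P)
          ... | no ny with present φ r d ny
          ...   | v , p with any? (Miss? φ v)
          ...     | no q = f v d (pathLead P) p (λ e x → q (e , x))
          ...     | yes (e , m) with _∈?_ _≟_ e (d ∷ vs)
          ...       | yes i with old P i
          ...         | inj₁ refl = fanHole (reached (pathLead P) p m) mz
          ...         | inj₂ (v' , g , L , p' , m' , j) = fanElem (reached (pathLead P) p m) (reached L p' m')
                          λ { refl → fresh P (subst (_∈ˡ vs) (same p' p) j) }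
          go zero rem le P inv | no ny | v , p | yes (e , m) | no i =
            ℕ.<-irrefl refl (ℕ.≤-trans (s≤s z≤n) (ℕ.≤-trans (x∈p⇒∣p-x∣<∣p∣ (inv e i)) le))
          go (suc N) rem le P inv | no ny | v , p | yes (e , m) | no i =
            go N (rem - e) (ℕ.≤-pred (ℕ.≤-trans (x∈p⇒∣p-x∣<∣p∣ (inv e i)) le)) (ext P v p m i)
              λ e' ne → x∈p∧x≢y⇒x∈p-y (inv e' λ j → ne (there j)) (λ { refl → ne (here refl) })

      -- Both paths are followed backwards from `d`, where they share vertices until one of them is
      -- used up or they come from different vertices missing the same colour.
      merge : ∀ {φ r c c' d Q} → FanPath φ r Q c d → FanPath φ r Q c' d → FanPath φ r Q c c' ⊎ FanPath φ r Q c' c ⊎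
        (∃ λ v → ∃ λ v' → ∃ λ e → ∃ λ f → ∃ λ f' → (FanPath φ r Q c f × col φ r v ≡ just f × Miss φ v e × Q v e) ×
          (FanPath φ r Q c' f' × col φ r v' ≡ just f' × Miss φ v' e × Q v' e) × v ≢ v')
      merge nil M = inj₂ (inj₁ M)
      merge L@(snoc _ _ _ _ _) nil = inj₁ L
      merge {φ} (snoc {e = e} L v p m q) (snoc M v' p' m' q') with v ≟ v'
      ... | no ne = inj₂ (inj₂ (v , v' , e , _ , _ , (L , p , m , q) , (M , p' , m' , q') , ne))
      ... | yes refl rewrite same p p' = merge L M

      compare : ∀ {φ r c d e} → (∀ {v x y z} → col φ r v ≡ just z → Miss φ v x → Miss φ v y → x ≡ y) →
        FreeFanPath φ r c d → FreeFanPath φ r c e → FreeFanPath φ r d e ⊎ FreeFanPath φ r e d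
      compare u nil M = inj₁ M
      compare {φ} u (snoc L v p m _) M with compare u L M
      ... | inj₂ X = inj₂ (snoc X v p m tt)
      ... | inj₁ X with uncons X
      ...   | inj₁ refl = inj₂ (snoc nil v p m tt)
      ...   | inj₂ (v' , x , p' , m' , _ , Y) with colProper φ p p'
      ...     | refl rewrite u p m m' = inj₁ Y

      -- A fan of one colour that runs into the other gives a fan vertex missing a colour of `z`;
      -- otherwise two vertices missing one colour are both linked to `r`.
      mergeHole : ∀ {φ r z a c c' d} → OneHole φ r z → Miss φ r a → Miss φ z c → Miss φ z c' → c ≢ c' →
        FreeFanPath φ r c d → FreeFanPath φ r c' d → ⊥
      mergeHole {φ} S missR mz mz' ne L M with merge L M
      ... | inj₁ nil = ne refl
      ... | inj₁ (snoc L v p m _) = Fan.fanHole S missR mz (reached L p m) mz'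
      ... | inj₂ (inj₁ nil) = ne refl
      ... | inj₂ (inj₁ (snoc L v p m _)) = Fan.fanHole S missR mz' (reached L p m) mz
      ... | inj₂ (inj₂ (v , v' , e , _ , _ , (L₁ , p , m , _) , (L₂ , p' , m' , _) , vv')) =
        Fan.fanLink S missR mz (reached L₁ p m) λ l → Fan.fanLink S missR mz' (reached L₂ p' m') λ l' →
        vv' (three φ (λ { refl → Fan.noA S missR mz (snoc L₁ v p m tt) }) (inj₁ missR) (inj₂ m) (inj₂ m') l l'
          (λ { refl → coloured⇒≢ φ p refl }) (λ { refl → coloured⇒≢ φ p' refl }))

-- Counting colours and neighbours

card-injective : ∀ {m l} (p : Subset m) (q : Subset l) (f : ∀ i → i ∈ p → Fin l) →
  (∀ i h → f i h ∈ q) → (∀ i j h h' → f i h ≡ f j h' → i ≡ j) → ∣ p ∣ ≤ ∣ q ∣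
card-injective [] q f mem inj = z≤n
card-injective (outside ∷ p) q f mem inj = card-injective p q (λ i h → f (suc i) (there h)) (λ i h → mem (suc i) (there h))
  λ i j h h' e → suc-injective (inj (suc i) (suc j) (there h) (there h') e)
card-injective (inside ∷ p) q f mem inj = ℕ.≤-trans
  (s≤s (card-injective p (q - f zero here) (λ i h → f (suc i) (there h))
    (λ i h → x∈p∧x≢y⇒x∈p-y (mem (suc i) (there h)) (λ e → case₀ (inj (suc i) zero (there h) here e)))
    λ i j h h' e → suc-injective (inj (suc i) (suc j) (there h) (there h') e)))
  (x∈p⇒∣p-x∣<∣p∣ (mem zero here))
  where
  case₀ : ∀ {m} {i : Fin m} → suc i ≡ zero → ⊥
  case₀ ()

∣p∣≤1+∣p-x∣ : ∀ {m} (p : Subset m) x → ∣ p ∣ ≤ suc ∣ p - x ∣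
∣p∣≤1+∣p-x∣ p x = card-injective p (inside ∷ (p - x)) (λ i _ → f i) mem λ i j _ _ → inj i j
  where
  f : ∀ i → Fin _
  f i with i ≟ x
  ... | yes _ = zero
  ... | no _ = suc i
  mem : ∀ i → i ∈ p → f i ∈ inside ∷ (p - x)
  mem i h with i ≟ x
  ... | yes _ = here
  ... | no ne = there (x∈p∧x≢y⇒x∈p-y h ne)
  inj : ∀ i j → f i ≡ f j → i ≡ j
  inj i j e with i ≟ x | j ≟ x
  ... | yes a | yes b = trans a (sym b)
  ... | no _ | no _ = suc-injective e

x∉p-x : ∀ {m} (p : Subset m) x → x ∈ p - x → ⊥
x∉p-x (inside ∷ p) zero ()
x∉p-x (outside ∷ p) zero ()
x∉p-x (inside ∷ p) (suc x) (there h) = x∉p-x p x h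
x∉p-x (outside ∷ p) (suc x) (there h) = x∉p-x p x h

removeAll : ∀ {k} → List (Fin k) → Subset k
removeAll [] = full
removeAll (c ∷ L) = removeAll L - c

∈removeAll : ∀ {k} {c : Fin k} L → All (c ≢_) L → c ∈ removeAll L
∈removeAll [] _ = ∈⊤
∈removeAll (d ∷ L) (p ∷ ps) = x∈p∧x≢y⇒x∈p-y (∈removeAll L ps) p

data Distinct {A : Set} : List A → Set where
  [] : Distinct []
  _∷_ : ∀ {x xs} → All (x ≢_) xs → Distinct xs → Distinct (x ∷ xs)

∣removeAll∣≤ : ∀ {k} {L : List (Fin k)} → Distinct L → ∣ removeAll L ∣ + length L ≤ k
∣removeAll∣≤ {k} [] = ℕ.≤-reflexive (trans (ℕ.+-identityʳ _) (∣⊤∣≡n k))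
∣removeAll∣≤ {k} {c ∷ L} (a ∷ d) = ℕ.≤-trans (ℕ.≤-reflexive (ℕ.+-suc _ _))
  (ℕ.≤-trans (ℕ.+-monoˡ-≤ (length L) (x∈p⇒∣p-x∣<∣p∣ (∈removeAll L a))) (∣removeAll∣≤ d))

∣removeAll∣≥ : ∀ {k} (L : List (Fin k)) → k ≤ ∣ removeAll L ∣ + length L
∣removeAll∣≥ {k} [] = ℕ.≤-reflexive (sym (trans (ℕ.+-identityʳ _) (∣⊤∣≡n k)))
∣removeAll∣≥ {k} (c ∷ L) = ℕ.≤-trans (∣removeAll∣≥ L)
  (ℕ.≤-trans (ℕ.+-monoˡ-≤ (length L) (∣p∣≤1+∣p-x∣ (removeAll L) c)) (ℕ.≤-reflexive (sym (ℕ.+-suc _ _))))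

avoid : ∀ {m k} (p : Subset m) (L : List (Fin k)) → Distinct L → (f : ∀ i → i ∈ p → Fin k) →
  (∀ i h → All (f i h ≢_) L) → (∀ i j h h' → f i h ≡ f j h' → i ≡ j) → ∣ p ∣ + length L ≤ k
avoid p L d f av inj = ℕ.≤-trans
  (ℕ.+-monoˡ-≤ (length L) (card-injective p (removeAll L) f (λ i h → ∈removeAll L (av i h)) inj)) (∣removeAll∣≤ d)

three∈ : ∀ {m} {p : Subset m} {x y z} → x ∈ p → y ∈ p → z ∈ p → x ≢ y → x ≢ z → y ≢ z → 3 ≤ ∣ p ∣
three∈ {p = p} {x} {y} {z} hx hy hz xy xz yz =
  ℕ.≤-trans (s≤s (s≤s (s≤s z≤n)))
    (ℕ.≤-trans (s≤s (s≤s (x∈p⇒∣p-x∣<∣p∣ hz'))) (ℕ.≤-trans (s≤s (x∈p⇒∣p-x∣<∣p∣ hy')) (x∈p⇒∣p-x∣<∣p∣ hx)))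
  where
  hy' : y ∈ p - x
  hy' = x∈p∧x≢y⇒x∈p-y hy (≢-sym xy)
  hz' : z ∈ p - x - y
  hz' = x∈p∧x≢y⇒x∈p-y (x∈p∧x≢y⇒x∈p-y hz (≢-sym xz)) (≢-sym yz)

≤foldr : ∀ {m} (f : Fin m → ℕ) i → f i ≤ foldr′ _⊔_ 0 (tabulate f)
≤foldr f zero = ℕ.m≤m⊔n _ _
≤foldr f (suc i) = ℕ.≤-trans (≤foldr (λ j → f (suc j)) i) (ℕ.m≤n⊔m _ _)

module _ {n : ℕ} (G : SimpleGraph n) where
  open SimpleGraph G using (adj)

  ∈N : ∀ {v w} → adj v w ≡ true → w ∈ N G v
  ∈N {v} {w} e = lookup⇒[]= w _ (trans (lookup∘tabulate _ w) (cong (toSide G) e))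

  N∈ : ∀ {v w} → w ∈ N G v → adj v w ≡ true
  N∈ {v} {w} h with adj v w in eq
  ... | true = refl
  ... | false with trans (sym ([]=⇒lookup h)) (trans (lookup∘tabulate (λ w → toSide G (adj v w)) w) (cong (toSide G) eq))
  ...   | ()

module Degrees (n k : ℕ) (G : SimpleGraph n) where
  open Moves n k public
  open Graph G public
  open SimpleGraph G using (adj)

  deg-lower : ∀ v (L : List C) (f : ∀ c → c ∈ removeAll L → V) → (∀ c h → adj v (f c h) ≡ true) →
    (∀ c d h h' → f c h ≡ f d h' → c ≡ d) → k ≤ deg G v + length L
  deg-lower v L f a inj = ℕ.≤-trans (∣removeAll∣≥ L)
    (ℕ.+-monoˡ-≤ (length L) (card-injective (removeAll L) (N G v) f (λ c h → ∈N G (a c h)) inj))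

  module Counts {φ : PartialColouring} {r z : V} (S : OneHole φ r z) where

    fullDeg : ∀ {v} → (∀ c → ¬ Miss φ v c) → k ≤ deg G v
    fullDeg {v} f = subst (k ≤_) (ℕ.+-identityʳ _) (deg-lower v [] (λ c _ → proj₁ (present φ v c (f c)))
      (λ c _ → OneHole.on S (proj₂ (present φ v c (f c))))
      λ c d _ _ e → same (proj₂ (present φ v c (f c)))
        (subst (λ w → col φ v w ≡ just d) (sym e) (proj₂ (present φ v d (f d)))))

    missing : ∀ {v} → deg G v < k → ∃ (Miss φ v)
    missing {v} lt with any? (Miss? φ v)
    ... | yes x = x
    ... | no q = ⊥-elim (ℕ.<-irrefl refl (ℕ.≤-trans lt (fullDeg λ c m → q (c , m))))

    missAway : ∀ {v} → v ≢ r → v ≢ z → ∀ L → Distinct L → All (Miss φ v) L → deg G v + length L ≤ k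
    missAway {v} vr vz L d ms = avoid (N G v) L d (λ w h → proj₁ (c w h))
      (λ w h → All.map (λ m e → m w (subst (λ x → col φ v w ≡ just x) e (proj₂ (c w h)))) ms)
      λ w w' h h' e → colProper φ (proj₂ (c w h)) (subst (λ x → col φ v w' ≡ just x) (sym e) (proj₂ (c w' h')))
      where
      c : ∀ w → w ∈ N G v → ∃ λ c → col φ v w ≡ just c
      c w h with OneHole.cov S (N∈ G h)
      ... | inj₂ x = x
      ... | inj₁ (inj₁ (e , _)) = ⊥-elim (vr e)
      ... | inj₁ (inj₂ (e , _)) = ⊥-elim (vz e)

    noMiss : ∀ {v c} → v ≢ r → v ≢ z → deg G v ≡ k → ¬ Miss φ v c
    noMiss vr vz e m = ℕ.<-irrefl refl (ℕ.≤-trans (ℕ.≤-reflexive (sym (trans (ℕ.+-comm _ 1) (cong suc e))))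
      (missAway vr vz _ ([] ∷ []) (m ∷ [])))

    unique : ∀ {v a b} → v ≢ r → v ≢ z → suc (deg G v) ≡ k → Miss φ v a → Miss φ v b → a ≡ b
    unique {v} {a} {b} vr vz e ma mb with a ≟ b
    ... | yes p = p
    ... | no p = ⊥-elim (ℕ.<-irrefl refl (ℕ.≤-trans (ℕ.≤-reflexive (sym (trans (ℕ.+-comm _ 2) (cong suc e))))
      (missAway vr vz (a ∷ b ∷ []) ((p ∷ []) ∷ [] ∷ []) (ma ∷ mb ∷ []))))

    notHole : ∀ {w c} → col φ r w ≡ just c → w ≢ z
    notHole p refl with trans (sym (OneHole.hole S)) p
    ... | ()

    -- The uncoloured edge uses a neighbour but no colour, so a colour is left over even at degree
    -- `k`.
    missingAtEnd : deg G r ≤ k → ∃ (Miss φ r)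
    missingAtEnd le with any? (Miss? φ r)
    ... | yes x = x
    ... | no q = ⊥-elim (ℕ.<-irrefl refl (ℕ.≤-trans (s≤s
        (subst (_≤ ∣ N G r - z ∣) (∣⊤∣≡n k) (card-injective full (N G r - z) (λ c _ → proj₁ (f c))
          (λ c _ → x∈p∧x≢y⇒x∈p-y (∈N G (OneHole.on S (proj₂ (f c)))) (notHole (proj₂ (f c))))
          λ c d _ _ e → same (proj₂ (f c)) (subst (λ w → col φ r w ≡ just d) (sym e) (proj₂ (f d))))))
        (ℕ.≤-trans (x∈p⇒∣p-x∣<∣p∣ (∈N G (OneHole.edge S))) le)))
      where
      f : ∀ c → ∃ λ w → col φ r w ≡ just c
      f c = present φ r c λ m → q (c , m)

    -- The neighbour z across the uncoloured edge stands for the colour a.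
    presentC : ∀ {a} L → Miss φ r a → (∀ c → c ∈ removeAll L → c ≢ a → ¬ Miss φ r c) → k ≤ deg G r + length L
    presentC {a} L ma f = deg-lower r L g adj' inj
      where
      gg : ∀ c → c ∈ removeAll L → Σ V λ w → (w ≡ z × c ≡ a) ⊎ col φ r w ≡ just c
      gg c h with c ≟ a
      ... | yes e = z , inj₁ (refl , e)
      ... | no ne = _ , inj₂ (proj₂ (present φ r c (f c h ne)))
      g : ∀ c → c ∈ removeAll L → V
      g c h = proj₁ (gg c h)
      adj' : ∀ c h → adj r (g c h) ≡ true
      adj' c h with gg c h
      ... | w , inj₁ (refl , _) = OneHole.edge S
      ... | w , inj₂ p = OneHole.on S p
      inj : ∀ c d h h' → g c h ≡ g d h' → c ≡ d
      inj c d h h' e with gg c h | gg d h'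
      ... | w , inj₁ (_ , p) | w' , inj₁ (_ , p') = trans p (sym p')
      ... | w , inj₁ (refl , _) | w' , inj₂ q = ⊥-elim (notHole q (sym e))
      ... | w , inj₂ q | w' , inj₁ (refl , _) = ⊥-elim (notHole q e)
      ... | w , inj₂ q | w' , inj₂ q' = same q (subst (λ x → col φ r x ≡ just d) (sym e) q')

    another : ∀ {a} → deg G r < k → Miss φ r a → ∃ λ b → b ≢ a × Miss φ r b
    another {a} lt ma with any? (λ b → Dec× b)
      where
      Dec× : ∀ b → Dec (b ≢ a × Miss φ r b)
      Dec× b = ¬? (b ≟ a) ×-dec Miss? φ r b
    ... | yes x = x
    ... | no q = ⊥-elim (ℕ.<-irrefl refl (ℕ.≤-trans lt
      (subst (k ≤_) (ℕ.+-identityʳ _) (presentC [] ma λ c _ ne m → q (c , ne , m)))))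

    yetAnother : ∀ {a b} → suc (deg G r) < k → Miss φ r a → ∃ λ c → c ≢ a × c ≢ b × Miss φ r c
    yetAnother {a} {b} lt ma with any? (λ c → Dec× c)
      where
      Dec× : ∀ c → Dec (c ≢ a × c ≢ b × Miss φ r c)
      Dec× c = ¬? (c ≟ a) ×-dec (¬? (c ≟ b) ×-dec Miss? φ r c)
    ... | yes x = x
    ... | no q = ⊥-elim (ℕ.<-irrefl refl (ℕ.≤-trans lt
      (subst (k ≤_) (ℕ.+-comm _ 1) (presentC (b ∷ []) ma λ c h ne m → q (c , ne , notb c h , m)))))
      where
      notb : ∀ c → c ∈ removeAll (b ∷ []) → c ≢ b
      notb c h refl = x∉p-x full b h

open SimpleGraph using () renaming (adj to adjacent; irrefl to loopless)

∧-true : ∀ {a b} → a ∧ b ≡ true → a ≡ true × b ≡ true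
∧-true {true} {true} _ = refl , refl

module _ {n : ℕ} (G : SimpleGraph n) where

  ∈Nd : ∀ {i v w} → adjacent G v w ≡ true → deg G w ≡ i → w ∈ Nd G i v
  ∈Nd {i} {v} {w} a refl = lookup⇒[]= w _ (trans (lookup∘tabulate _ w)
    (cong (toSide G) (cong₂ _∧_ a (lem (deg G w)))))
    where
    lem : ∀ m → (m ≡ᵇ m) ≡ true
    lem zero = refl
    lem (suc m) = lem m

  Nd∈ : ∀ {i v w} → w ∈ Nd G i v → adjacent G v w ≡ true × deg G w ≡ i
  Nd∈ {i} {v} {w} h = proj₁ both , ℕ.≡ᵇ⇒≡ _ _ (subst Bool.T (sym (proj₂ both)) tt)
    where
    val : ∀ b → toSide G b ≡ inside → b ≡ true
    val true _ = refl
    both = ∧-true (val _ (trans (sym (lookup∘tabulate _ w)) ([]=⇒lookup h)))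

-- Critical subgraphs

_⊑_ : ∀ {n} → SimpleGraph n → SimpleGraph n → Set
H ⊑ G = ∀ {u v} → adjacent H u v ≡ true → adjacent G u v ≡ true

module Critical {n : ℕ} (k : ℕ) (G : SimpleGraph n) (deg≤ : ∀ v → deg G v ≤ k)
  (core≤2 : ∀ v → deg G v ≡ k → ∣ Nd G k v ∣ ≤ 2) (H : SimpleGraph n) (sub : H ⊑ G)
  (nc : Moves.Graph.NonCol n k H) (crit : ∀ {u v} → adjacent H u v ≡ true → (∀ φ → Moves.Graph.OneHole n k H φ u v → ⊥) → ⊥)
  where
  open Degrees n k H

  degH≤ : ∀ v → deg H v ≤ deg G v
  degH≤ v = card-injective (N H v) (N G v) (λ w _ → w) (λ w h → ∈N G (sub (N∈ H h))) (λ _ _ _ _ e → e)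

  degH≤k : ∀ v → deg H v ≤ k
  degH≤k v = ℕ.≤-trans (degH≤ v) (deg≤ v)

  coreUp : ∀ {v} → deg H v ≡ k → deg G v ≡ k
  coreUp {v} e = ℕ.≤-antisym (deg≤ v) (subst (_≤ deg G v) e (degH≤ v))

  hsym : ∀ {u v} → adjacent H u v ≡ true → adjacent H v u ≡ true
  hsym {u} {v} a = trans (SimpleGraph.sym H v u) a

  -- The last fan vertex sees all `k` colours, so its degree is `k`.
  fanEndsInCore : ∀ {φ r z a c} → OneHole φ r z → Miss φ r a → Miss φ z c →
    (∀ y d → FreeFanPath φ r c d → col φ r y ≡ just d → adjacent H r y ≡ true → y ≢ z → deg H y ≡ k → ⊥) → ⊥
  fanEndsInCore S missR mz f = Fan.pathEnd nc S missR mz λ y d L p full →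
    f y d L p (OneHole.on S p) (Counts.notHole S p) (ℕ.≤-antisym (degH≤k y) (Counts.fullDeg S full))

  -- The part of Vizing's adjacency lemma that is needed to reach further core vertices from any
  -- edge.
  anotherCore : ∀ {r z} → adjacent H r z ≡ true → (∀ y → adjacent H r y ≡ true → y ≢ z → deg H y ≡ k → ⊥) → ⊥
  anotherCore {r} {z} a f = crit a λ φ S →
    fanEndsInCore S (proj₂ (Counts.missingAtEnd S (degH≤k r))) (proj₂ (Counts.missingAtEnd (holeSym S) (degH≤k z)))
      λ y d L p → f y

  threeCore : ∀ {r x y z} → deg G r ≡ k → adjacent G r x ≡ true → adjacent G r y ≡ true → adjacent G r z ≡ true →
    deg G x ≡ k → deg G y ≡ k → deg G z ≡ k → x ≢ y → x ≢ z → y ≢ z → ⊥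
  threeCore {r} e adjXW ay az dx dy dz xy xz yz = ℕ.<-irrefl refl (ℕ.≤-trans
    (three∈ (∈Nd G adjXW dx) (∈Nd G ay dy) (∈Nd G az dz) xy xz yz) (core≤2 r e))

  -- With a smaller degree `z` would miss three colours. Their fans never arrive at a common colour,
  -- so they end at three different core neighbours of `r`.
  nearCore : ∀ {r z} → deg H r ≡ k → adjacent H r z ≡ true → k ≤ suc (deg H z)
  nearCore {r} {z} e a with k ℕ.≤? suc (deg H z)
  ... | yes p = p
  ... | no np = ⊥-elim (crit a λ φ S → contra φ S)
    where
    lt : suc (deg H z) < k
    lt = ℕ.≰⇒> np
    contra : ∀ φ → OneHole φ r z → ⊥
    contra φ S with Counts.missingAtEnd S (degH≤k r) | Counts.missingAtEnd (holeSym S) (degH≤k z)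
    ... | a₀ , ma | c₁ , m₁ with Counts.another (holeSym S) (ℕ.<-trans (ℕ.n<1+n _) lt) m₁
    ...   | c₂ , c₂≢ , m₂ with Counts.yetAnother (holeSym S) {b = c₂} lt m₁
    ...     | c₃ , c₃≢₁ , c₃≢₂ , m₃ =
      fanEndsInCore S ma m₁ λ y₁ d₁ L₁ p₁ a₁ _ e₁ → fanEndsInCore S ma m₂ λ y₂ d₂ L₂ p₂ a₂ _ e₂ → fanEndsInCore S ma m₃ λ y₃ d₃ L₃ p₃ a₃ _ e₃ →
        threeCore (coreUp e) (sub a₁) (sub a₂) (sub a₃) (coreUp e₁) (coreUp e₂) (coreUp e₃)
          (apart m₁ m₂ (≢-sym c₂≢) L₁ L₂ p₁ p₂) (apart m₁ m₃ (≢-sym c₃≢₁) L₁ L₃ p₁ p₃) (apart m₂ m₃ (≢-sym c₃≢₂) L₂ L₃ p₂ p₃)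
      where
      apart : ∀ {c c' d d' y y'} → Miss φ z c → Miss φ z c' → c ≢ c' → FreeFanPath φ r c d → FreeFanPath φ r c' d' →
        col φ r y ≡ just d → col φ r y' ≡ just d' → y ≢ y'
      apart m m' ne L L' p p' refl rewrite same p p' = mergeHole nc S ma m m' ne L L'

  -- An edge pw of G outside H, with p on an edge of H, would give a third core neighbour to a core vertex.
  spreads : ∀ {p z w} → adjacent H p z ≡ true → adjacent G p w ≡ true → adjacent H p w ≡ true
  spreads {p} {z} {w} a g with adjacent H p w in eq
  ... | true = refl
  ... | false = ⊥-elim (anotherCore a λ y ay _ ey → anotherCore (hsym ay) λ y₁ a₁ ne₁ e₁ → anotherCore a₁ λ y₂ a₂ ne₂ e₂ →
      threeCore (coreUp ey) (sub (hsym ay)) (sub a₁) (sub a₂) (coreP ey ay) (coreUp e₁) (coreUp e₂)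
        (≢-sym ne₁) (λ { refl → ℕ.<-irrefl e₂ less }) (≢-sym ne₂))
    where
    lessG : deg H p < deg G p
    lessG = ℕ.≤-trans (s≤s (card-injective (N H p) (N G p - w) (λ v _ → v)
      (λ v h → x∈p∧x≢y⇒x∈p-y (∈N G (sub (N∈ H h))) λ { refl → not-edge (N∈ H h) }) (λ _ _ _ _ e → e)))
      (x∈p⇒∣p-x∣<∣p∣ (∈N G g))
      where
      not-edge : adjacent H p w ≡ true → ⊥
      not-edge x with trans (sym eq) x
      ... | ()
    less : deg H p < k
    less = ℕ.≤-trans lessG (deg≤ p)
    coreP : ∀ {y} → deg H y ≡ k → adjacent H p y ≡ true → deg G p ≡ k
    coreP ey ay = ℕ.≤-antisym (deg≤ p) (ℕ.≤-trans (nearCore ey (hsym ay)) lessG)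

-- Deleting edges down to a critical subgraph

module _ {n : ℕ} (k : ℕ) where
  open Moves n k

  del : SimpleGraph n → Fin n → Fin n → SimpleGraph n
  del G p q = record
    { adj = λ u v → adjacent G u v ∧ not ⌊ Edge? p q u v ⌋
    ; sym = λ u v → cong₂ (λ a b → a ∧ not b) (SimpleGraph.sym G u v) (turnE u v)
    ; irrefl = λ v → cong (_∧ not ⌊ Edge? p q v v ⌋) (loopless G v) }
    where
    turnE : ∀ u v → ⌊ Edge? p q u v ⌋ ≡ ⌊ Edge? p q v u ⌋
    turnE u v with Edge? p q u v | Edge? p q v u
    ... | yes _ | yes _ = refl
    ... | no _ | no _ = refl
    ... | yes (inj₁ (a , b)) | no x = ⊥-elim (x (inj₂ (b , a)))
    ... | yes (inj₂ (a , b)) | no x = ⊥-elim (x (inj₁ (b , a)))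
    ... | no x | yes (inj₁ (a , b)) = ⊥-elim (x (inj₂ (b , a)))
    ... | no x | yes (inj₂ (a , b)) = ⊥-elim (x (inj₁ (b , a)))

  del⊑ : ∀ G {p q} → del G p q ⊑ G
  del⊑ G e = proj₁ (∧-true e)

  delNot : ∀ G {p q u v} → adjacent (del G p q) u v ≡ true → ¬ ((u ≡ p × v ≡ q) ⊎ (u ≡ q × v ≡ p))
  delNot G {p} {q} {u} {v} e x with proj₂ (∧-true {adjacent G u v} e)
  ... | y with Edge? p q u v
  delNot G e x | () | yes _
  ... | no z = z x

  delIn : ∀ G {p q u v} → adjacent G u v ≡ true → ¬ ((u ≡ p × v ≡ q) ⊎ (u ≡ q × v ≡ p)) → adjacent (del G p q) u v ≡ true
  delIn G {p} {q} {u} {v} e x with Edge? p q u v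
  ... | yes y = ⊥-elim (x y)
  ... | no _ rewrite e = refl

  adjne : ∀ (G : SimpleGraph n) {u v} → adjacent G u v ≡ true → u ≢ v
  adjne G {u} a refl with trans (sym (loopless G u)) a
  ... | ()

  delHole : ∀ G {p q} → adjacent G p q ≡ true → (∀ φ → Moves.Graph.OneHole n k G φ p q → ⊥) → Moves.Graph.NonCol n k (del G p q)
  delHole G {p} {q} a f φ on cov = f φ (record
    { edge = a ; on = λ x → del⊑ G (on x) ; cov = cov' ; hole = hole })
    where
    cov' : ∀ {u v} → adjacent G u v ≡ true → ((u ≡ p × v ≡ q) ⊎ (u ≡ q × v ≡ p)) ⊎ ∃ λ c → col φ u v ≡ just c
    cov' {u} {v} e with Edge? p q u v
    ... | yes x = inj₁ x
    ... | no x = inj₂ (cov (delIn G e x))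
    hole : col φ p q ≡ nothing
    hole with col φ p q in eq
    ... | nothing = refl
    ... | just c = ⊥-elim (delNot G (on eq) (inj₁ (refl , refl)))

  -- Edges already known to be critical stay critical when another edge is deleted.
  holeDel : ∀ G {p q u v φ} → adjacent (del G p q) u v ≡ true → Moves.Graph.OneHole n k G φ u v →
    adjacent G p q ≡ true → ∃ λ ψ → Moves.Graph.OneHole n k (del G p q) ψ u v
  holeDel G {p} {q} {u} {v} {φ} e S a with uncolourEdge φ (adjne G a)
  ... | ψ , U = ψ , record { edge = e ; on = on' ; cov = cov' ; hole = trans (Recoloured.old U (delNot G e)) (Graph.OneHole.hole S) }
    where
    on' : ∀ {x y c} → col ψ x y ≡ just c → adjacent (del G p q) x y ≡ true
    on' {x} {y} h with Edge? p q x y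
    ... | yes (inj₁ (refl , refl)) with trans (sym (Recoloured.new U)) h
    ...   | ()
    on' {x} {y} h | yes (inj₂ (refl , refl)) with trans (sym (flip ψ (Recoloured.new U))) h
    ...   | ()
    on' {x} {y} h | no z rewrite Graph.OneHole.on S (trans (sym (Recoloured.old U z)) h) = refl
    cov' : ∀ {x y} → adjacent (del G p q) x y ≡ true → ((x ≡ u × y ≡ v) ⊎ (x ≡ v × y ≡ u)) ⊎ ∃ λ c → col ψ x y ≡ just c
    cov' h with Graph.OneHole.cov S (del⊑ G h)
    ... | inj₁ x = inj₁ x
    ... | inj₂ (c , x) = inj₂ (c , trans (Recoloured.old U (delNot G h)) x)

  module _ (G : SimpleGraph n) (conn : Connected G) (deg≤ : ∀ v → deg G v ≤ k)
    (core≤2 : ∀ v → deg G v ≡ k → ∣ Nd G k v ∣ ≤ 2) where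

    -- `H` has an edge, since otherwise the empty colouring would be complete; by `spreads` its
    -- edges then propagate along the walks of the connected graph `G`.
    criticalIsAll : ∀ H → H ⊑ G → Moves.Graph.NonCol n k H →
      (∀ {u v} → adjacent H u v ≡ true → (∀ φ → Moves.Graph.OneHole n k H φ u v → ⊥) → ⊥) →
      ∀ {r z} → adjacent G r z ≡ true → ¬ ¬ (adjacent H r z ≡ true)
    criticalIsAll H sub nc crit {r} {z} a f = noEdge λ u v e → f (spreads (proj₂ (travel (conn u r) e)) a)
      where
      open Critical k G deg≤ core≤2 H sub nc crit
      travel : ∀ {u v w} → Reach G u v → adjacent H u w ≡ true → ∃ λ w' → adjacent H v w' ≡ true
      travel here e = _ , e
      travel (step g R) e = travel R (hsym (spreads e g))
      noEdge : (∀ u v → adjacent H u v ≡ true → ⊥) → ⊥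
      noEdge g = nc emptyColouring (λ ()) (λ e → ⊥-elim (g _ _ e))
        where
        emptyColouring : PartialColouring
        emptyColouring = record { col = λ _ _ → nothing ; colSym = λ _ _ → refl ; colProper = λ () ; colIrrefl = λ _ → refl }

    -- Edges outside the list `ps` are already critical. Criticality of `p q` need not be decided:
    -- if `p q` can be deleted, the recursion on the smaller graph already yields the edge `r z`, so
    -- otherwise `p q` may be assumed critical.
    shrink : ∀ (ps : List (Fin n × Fin n)) H → H ⊑ G → Moves.Graph.NonCol n k H →
      (∀ {u v} → adjacent H u v ≡ true → ((u , v) ∈ˡ ps) ⊎ ((∀ φ → Moves.Graph.OneHole n k H φ u v → ⊥) → ⊥)) →
      ∀ {r z} → adjacent G r z ≡ true → ¬ ¬ (adjacent H r z ≡ true)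
    shrink [] H sub nc f = criticalIsAll H sub nc λ e → [ (λ ()) , (λ g → g) ]′ (f e)
    shrink ((p , q) ∷ ps) H sub nc f {r} {z} a g with adjacent H p q in eq
    ... | false = shrink ps H sub nc (λ e → drop e (f e)) a g
      where
      drop : ∀ {u v} → adjacent H u v ≡ true → ((u , v) ∈ˡ (p , q) ∷ ps) ⊎ ((∀ φ → Moves.Graph.OneHole n k H φ u v → ⊥) → ⊥) →
             ((u , v) ∈ˡ ps) ⊎ ((∀ φ → Moves.Graph.OneHole n k H φ u v → ⊥) → ⊥)
      drop e (inj₁ (here refl)) with trans (sym eq) e
      ... | ()
      drop e (inj₁ (there i)) = inj₁ i
      drop e (inj₂ x) = inj₂ x
    ... | true = shrink ps H sub nc (λ e → keep (f e)) a g
      where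
      removable : (∀ φ → Moves.Graph.OneHole n k H φ p q → ⊥) → ⊥
      removable h = shrink ps (del H p q) (λ e → sub (del⊑ H e)) (delHole H eq h) (λ e → keep' e (f (del⊑ H e))) a
        λ e → g (del⊑ H e)
        where
        keep' : ∀ {u v} → adjacent (del H p q) u v ≡ true →
          ((u , v) ∈ˡ (p , q) ∷ ps) ⊎ ((∀ φ → Moves.Graph.OneHole n k H φ u v → ⊥) → ⊥) →
          ((u , v) ∈ˡ ps) ⊎ ((∀ φ → Moves.Graph.OneHole n k (del H p q) φ u v → ⊥) → ⊥)
        keep' e (inj₁ (here refl)) = ⊥-elim (delNot H e (inj₁ (refl , refl)))
        keep' e (inj₁ (there i)) = inj₁ i
        keep' e (inj₂ x) = inj₂ λ y → x λ φ S → y _ (proj₂ (holeDel H e S eq))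
      keep : ∀ {u v} → ((u , v) ∈ˡ (p , q) ∷ ps) ⊎ ((∀ φ → Moves.Graph.OneHole n k H φ u v → ⊥) → ⊥) →
             ((u , v) ∈ˡ ps) ⊎ ((∀ φ → Moves.Graph.OneHole n k H φ u v → ⊥) → ⊥)
      keep (inj₁ (here refl)) = inj₂ removable
      keep (inj₁ (there i)) = inj₁ i
      keep (inj₂ x) = inj₂ x

    -- Every single edge is critical: otherwise a critical subgraph avoiding it exists, and that must be all of G.
    critical : ∀ {r z} → adjacent G r z ≡ true → (∀ φ → Moves.Graph.OneHole n k G φ r z → ⊥) → ⊥
    critical {r} {z} a f = shrink (cartesianProduct (allFin n) (allFin n)) (del G r z) (del⊑ G) (delHole G a f)
      (λ {u} {v} _ → inj₁ (∈-cartesianProduct⁺ (∈-allFin u) (∈-allFin v))) a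
      λ e → delNot G e (inj₁ (refl , refl))

-- Fans at an uncoloured core edge

module CriticalGraph {n : ℕ} (k : ℕ) (G : SimpleGraph n) (deg≤ : ∀ v → deg G v ≤ k)
  (core≤2 : ∀ v → deg G v ≡ k → ∣ Nd G k v ∣ ≤ 2)
  (nc : Moves.Graph.NonCol n k G)
  (crit : ∀ {u v} → SimpleGraph.adj G u v ≡ true → (∀ φ → Moves.Graph.OneHole n k G φ u v → ⊥) → ⊥) where

  open Degrees n k G public
  open SimpleGraph G using (adj)
  module Crit = Critical k G deg≤ core≤2 G (λ e → e) nc crit

  IsCore IsSubcore : V → Set
  IsCore v = deg G v ≡ k
  IsSubcore v = suc (deg G v) ≡ k

  adjSym : ∀ {u v} → adj u v ≡ true → adj v u ≡ true
  adjSym = Crit.hsym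

  coreOrSubcore : ∀ {r v} → IsCore r → adj r v ≡ true → IsCore v ⊎ IsSubcore v
  coreOrSubcore {r} {v} t a with ℕ.≤⇒≤′ (deg≤ v) | Crit.nearCore t a
  ... | _ | le with deg G v ℕ.≟ k
  ...   | yes e = inj₁ e
  ...   | no ne = inj₂ (ℕ.≤-antisym (ℕ.≤∧≢⇒< (deg≤ v) ne) le)

  swapPath : ∀ {φ ψ a b u r c d} {Q : V → C → Set} → Swapped φ ψ a b u → ¬ Link φ a b u r →
    (∀ {v e} → Q v e → e ≢ a × e ≢ b) → FanPath φ r Q c d → FanPath ψ r Q c d
  swapPath K nl f = mapPath λ L p m q → trans (Swapped.colOut K nl _) p , Swapped.missOther K (proj₁ (f q)) (proj₂ (f q)) m , q

  avoids : V → V → C → Set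
  avoids w v _ = v ≢ w

  module Pair (r x : V) (rT : IsCore r) (xT : IsCore x) where

    record State (φ : PartialColouring) (α β : C) : Set where
      constructor state
      field
        holeRX : OneHole φ r x
        missR : Miss φ r α
        missX : Miss φ x β

      α≢β : α ≢ β
      α≢β refl = clash nc holeRX missR missX

      module F = Fan nc holeRX missR missX

      ends-linked : ¬ ¬ Link φ α β r x
      ends-linked = holeLinked nc holeRX missR missX

      -- The chain at `r` has its second end at `x`.
      off : ∀ {v} → v ≢ r → v ≢ x → End φ α β v → ¬ Link φ α β r v
      off vr vx e L = ends-linked λ L' → vx (three φ α≢β (inj₁ missR) e (inj₂ missX) L L' vr (λ q → OneHole.r≢z holeRX (sym q)))

      r≢ : ∀ {w c} → col φ x w ≡ just c → r ≢ w
      r≢ p refl with trans (sym (flip φ (OneHole.hole holeRX))) p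
      ... | ()

      x≢ : ∀ {v c} → col φ r v ≡ just c → v ≢ x
      x≢ p = Counts.notHole holeRX p

      uniqueMissing : ∀ {v a b} → v ≢ r → v ≢ x → IsCore v ⊎ IsSubcore v → Miss φ v a → Miss φ v b → a ≡ b
      uniqueMissing vr vx (inj₁ t) ma _ = ⊥-elim (Counts.noMiss holeRX vr vx t ma)
      uniqueMissing vr vx (inj₂ d) ma mb = Counts.unique holeRX vr vx d ma mb

      uniqueMissingNbr : ∀ {v a b c} → col φ r v ≡ just c → Miss φ v a → Miss φ v b → a ≡ b
      uniqueMissingNbr p = uniqueMissing (λ { refl → coloured⇒≢ φ p refl }) (x≢ p) (coreOrSubcore rT (OneHole.on holeRX p))

      colX : ∀ {w} → adj x w ≡ true → w ≢ r → ∃ λ c → col φ x w ≡ just c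
      colX a ne with OneHole.cov holeRX a
      ... | inj₂ y = y
      ... | inj₁ (inj₁ (e , _)) = ⊥-elim (OneHole.r≢z holeRX (sym e))
      ... | inj₁ (inj₂ (_ , e)) = ⊥-elim (ne e)

      colR : ∀ {w} → adj r w ≡ true → w ≢ x → ∃ λ c → col φ r w ≡ just c
      colR a ne with OneHole.cov holeRX a
      ... | inj₂ y = y
      ... | inj₁ (inj₁ (_ , e)) = ⊥-elim (ne e)
      ... | inj₁ (inj₂ (e , _)) = ⊥-elim (OneHole.r≢z holeRX e)

    open State

    splitLink : ∀ φ a b u v → (Link φ a b u v → ⊥) → (¬ Link φ a b u v → ⊥) → ⊥
    splitLink φ a b u v f g = g f

    -- The first of the two moves. `r` keeps `α` because it is off the chain; `x` keeps `β` even
    -- when `e` is `β`, because it then lies on the chain of `r`.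
    flipA : ∀ {φ α β v e} → State φ α β → ¬ Link φ α e r v →
      (∀ ψ → Swapped φ ψ α e v → State ψ α β → ¬ Link φ α e v r → ⊥) → ⊥
    flipA {φ} {α} {β} {v} {e} s nl f = ends-linked s λ Lrx → swapComponent φ α e v λ ψ K →
      f ψ K (state (holeSwapped K (holeRX s)) (Swapped.outMiss K nl' (missR s)) (keep K Lrx (β ≟ e))) nl'
      where
      nl' : ¬ Link φ α e v r
      nl' l = nl (linkSym φ l)
      keep : ∀ {ψ} → Swapped φ ψ α e v → Link φ α β r x → Dec (β ≡ e) → Miss ψ x β
      keep K L (yes refl) = Swapped.outMiss K (λ l → nl (L ◅◅ linkSym φ l)) (missX s)
      keep K L (no ne) = Swapped.missOther K (λ q → α≢β s (sym q)) ne (missX s)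

    xOff : ∀ {φ α β v} → State φ α β → ¬ Link φ α β r v → ¬ Link φ α β v x
    xOff {φ} s nl l = ends-linked s λ L → nl (L ◅◅ linkSym φ l)

    -- The second move. Afterwards `w` again misses the colour that `x` misses, so the move can be
    -- reversed.
    toggle : ∀ {φ α β w γ} → State φ α β → Miss φ w β → col φ x w ≡ just γ →
      ∃ λ ψ → Recoloured φ ψ x w (just β) × State ψ α γ × Miss ψ w γ × col ψ x w ≡ just β
    toggle {φ} {α} {β} {w} {γ} s missW p with recolourEdge φ (coloured⇒≢ φ p) (missX s) missW
    ... | ψ , U = ψ , U , state (holeRecoloured U p (holeRX s)) (Recoloured.awayMiss U (OneHole.r≢z (holeRX s)) (r≢ s p) (missR s))
        (Recoloured.gainP U (coloured⇒≢ φ p) p β≢γ) , Recoloured.gainP (recolouredSym U) (≢-sym (coloured⇒≢ φ p)) (flip φ p) β≢γ , Recoloured.new U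
      where
      β≢γ : just β ≢ just γ
      β≢γ refl = missX s w p

    togglePath : ∀ {φ ψ α β w m c d} {Q : V → C → Set} → State φ α β → Recoloured φ ψ x w m → r ≢ w → (∀ {v e} → Q v e → v ≢ w) →
      FanPath φ r Q c d → FanPath ψ r Q c d
    togglePath s U rw f = mapPath λ L p m q →
      trans (Recoloured.away U (OneHole.r≢z (holeRX s)) rw _) p , Recoloured.awayMiss U (x≢ s p) (f q) m , q

    togglePath⁻ : ∀ {φ ψ α β w m c d} {Q : V → C → Set} → State ψ α β → Recoloured φ ψ x w m → r ≢ w → (∀ {v e} → Q v e → v ≢ w) →
      FanPath ψ r Q c d → FanPath φ r Q c d
    togglePath⁻ {φ} {ψ} s U rw f = mapPath λ {d} {v} L p m q →
      trans (sym (Recoloured.away U (OneHole.r≢z (holeRX s)) rw _)) p ,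
      (λ u e → m u (trans (Recoloured.away U (x≢ s p) (f q) u) e)) , q

    avoid-w : ∀ {φ α β w d} → State φ α β → Miss φ w β → FreeFanPath φ r β d → FanPath φ r (avoids w) β d
    avoid-w s missW = mapPath λ L p m _ → p , m , λ { refl → F.fanHole s (reached L p missW) (missX s) }

    -- Toggling `x w` makes `x` miss `β`, and a fan that avoids `w` does not notice.
    noPathα : ∀ {φ α δ w β} → State φ α δ → Miss φ w δ → col φ x w ≡ just β → FanPath φ r (avoids w) β α → ⊥
    noPathα s missW p L with toggle s missW p
    ... | ψ , U , s' , mw' , p' with togglePath s U (r≢ s p) (λ q → q) L
    ...   | L' = noPath nc (holeRX s'') (missX s'') (missR s'') L'
      where s'' = s'

    -- After toggling, the fan of `β` would contain `w`, which misses the same colour as `x`.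
    noPathτ : ∀ {φ α δ w β τ} → State φ α δ → Miss φ w δ → col φ x w ≡ just β → col φ r w ≡ just τ →
      FanPath φ r (avoids w) β τ → ⊥
    noPathτ {w = w} s missW p notAdjR L with toggle s missW p
    ... | ψ , U , s' , mw' , p' =
      F.fanHole s' (reached (forget (togglePath s U (r≢ s p) (λ q → q) L))
        (trans (Recoloured.away U (OneHole.r≢z (holeRX s)) (r≢ s p) w) notAdjR) mw') (missX s')

    -- The fans of β before and of γ after toggling end at the same core neighbour of r, so that one of
    -- them runs into the other.
    orient : ∀ {φ α β w γ} → State φ α β → Miss φ w β → col φ x w ≡ just γ →
      (FanPath φ r (avoids w) β γ → ⊥) →
      (∀ ψ → Recoloured φ ψ x w (just β) → State ψ α γ → Miss ψ w γ → col ψ x w ≡ just β → FanPath ψ r (avoids w) γ β → ⊥) → ⊥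
    orient {φ} {α} {β} {w} {γ} s missW p f g with toggle s missW p
    ... | ψ , U , s' , mw' , p' =
      Crit.fanEndsInCore (holeRX s) (missR s) (missX s) λ y d L py ay yx ey →
      Crit.fanEndsInCore (holeRX s') (missR s') (missX s') λ y' d' L' py' ay' yx' ey' →
      tops y y' d d' L py L' py' (sameTop ay yx ey ay' yx' ey')
      where
      rw = r≢ s p
      sameTop : ∀ {y y'} → adj r y ≡ true → y ≢ x → IsCore y → adj r y' ≡ true → y' ≢ x → IsCore y' → ¬ ¬ (y ≡ y')
      sameTop a ne e a' ne' e' z = Crit.threeCore rT (OneHole.edge (holeRX s)) a a' xT e e' (≢-sym ne) (≢-sym ne') z
      tops : ∀ y y' d d' → FreeFanPath φ r β d → col φ r y ≡ just d → FreeFanPath ψ r γ d' → col ψ r y' ≡ just d' → ¬ ¬ (y ≡ y') → ⊥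
      tops y y' d d' L py L' py' eq = eq λ { refl → go (same (trans (Recoloured.away U (OneHole.r≢z (holeRX s)) rw y) py) py') }
        where
        toψ : ∀ {c e} → FanPath φ r (avoids w) c e → FanPath ψ r (avoids w) c e
        toψ = togglePath s U rw (λ q → q)
        toφ : ∀ {c e} → FanPath ψ r (avoids w) c e → FanPath φ r (avoids w) c e
        toφ = togglePath⁻ s' U rw (λ q → q)
        go : d ≡ d' → ⊥
        go refl with merge nc (toψ (avoid-w s missW L)) (avoid-w s' mw' L')
        ... | inj₁ M = f (toφ M)
        ... | inj₂ (inj₁ M) = g ψ U s' mw' p' M
        -- Here `v` and `v'` miss the same `e`. As `v'` is on the chain of `r`, a change at `v`
        -- makes `v` miss `α`, and in the toggled colouring the fan of `β` then arrives at `α`.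
        ... | inj₂ (inj₂ (v , v' , e , c , c' , (M , q , m , vw) , (M' , q' , m' , _) , vv')) =
          F.fanLink s' (reached (forget M') q' m') λ l' →
          flipA s' (λ l → vv' (three ψ (λ { refl → noPathα s' mw' p' (snoc M v q m vw) })
            (inj₁ (missR s')) (inj₂ m) (inj₂ m') l l' (λ { refl → coloured⇒≢ ψ q refl }) (λ { refl → coloured⇒≢ ψ q' refl })))
          λ χ K t nl → noPathα t (Swapped.missOther K (≢-sym (α≢β s')) (λ { refl → F.fanHole s' (reached (forget M') q' m') (missX s') }) mw')
            (Swapped.keepOther K (≢-sym (α≢β s)) e≢β p')
            ([ (λ X → snoc X v (trans (Swapped.colOut K nl v) q) (Swapped.missB K ε m) vw) , (λ X → X) ]′
              (swapPathOrHit nc {Q = avoids w} (λ z → z) K nl (noPathα s' mw' p') M))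
          where
          e≢β : β ≢ e
          e≢β refl with toφ (snoc M v q m vw)
          ... | nil = β≢β
            where
            β≢β : ⊥
            β≢β = F.fanHole s (reached (forget (toφ M)) (trans (sym (Recoloured.away U (OneHole.r≢z (holeRX s)) rw v)) q)
              (λ u z → m u (trans (Recoloured.away U (x≢ s' q) vw u) z))) (missX s)
          ... | snoc X u a b _ = F.fanHole s (reached (forget X) a b) (missX s)

    -- δ recurs on the fan of β: freed by τ = rt, the first vertex missing δ is made to point back to t.
    fanCommon : ∀ {ψ α δ t β} → State ψ α δ → adj r t ≡ true → Miss ψ t δ → col ψ x t ≡ just β →
      FanPath ψ r (avoids t) β δ → ⊥
    fanCommon {ψ} {α} {δ} {t} {β} s at mt p L with first (λ e → e ≟ δ) L
    ... | inj₁ nil = mt x (flip ψ p)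
    ... | inj₁ (snoc _ _ _ _ (_ , ne)) = ne refl
    ... | inj₂ (f , v , .δ , M , q , m , vt , refl) with colR s at (≢-sym (coloured⇒≢ ψ p))
    ...   | τ , pτ = splitLink ψ α δ t v joined apart
      where
      rt : r ≢ t
      rt = r≢ s p
      tx : t ≢ x
      tx = ≢-sym (coloured⇒≢ ψ p)
      vr : v ≢ r
      vr refl = coloured⇒≢ ψ q refl
      offv = off s vr (x≢ s q) (inj₂ m)
      offt = off s (≢-sym rt) tx (inj₂ mt)
      apart : ¬ Link ψ α δ t v → ⊥
      apart nl = flipA s offv λ χ K s₁ nr → noPathα s₁ (Swapped.outMiss K (λ l → nl (linkSym ψ l)) mt)
        (trans (Swapped.colOut K (xOff s offv) t) p)
        ([ (λ X → snoc X v (trans (Swapped.colOut K nr v) q) (Swapped.missB K ε m) vt) , (λ X → X) ]′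
          (swapPathOrHit nc {Q = avoids t} (λ z → z) K nr (noPathα s mt p) (mapPath (λ { _ a b (c , _) → a , b , c }) M)))
      Q : V → C → Set
      Q u e = u ≢ t × e ≢ α × e ≢ δ × e ≢ τ
      M' : FanPath ψ r Q β f
      M' = mapPath (λ { {d} {u} {e} X a b (c , ne) → a , b , c ,
        (λ { refl → noPathα s mt p (snoc (mapPath (λ { _ a b (c , _) → a , b , c }) X) u a b c) }) , ne ,
        (λ { refl → noPathτ s mt p pτ (snoc (mapPath (λ { _ a b (c , _) → a , b , c }) X) u a b c) }) }) M
      joined : Link ψ α δ t v → ⊥
      joined l = flipA s offt λ χ K s₁ nr →
        let mt₁ = Swapped.missB K ε mt
            mv₁ = Swapped.missB K l m
            pτ₁ = trans (Swapped.colOut K nr t) pτ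
            M₁ = swapPath K nr (λ { (_ , a , b , _) → a , b }) M'
            p₁ = trans (Swapped.colOut K (xOff s offt) t) p
            q₁ = trans (Swapped.colOut K nr v) q
            α≢τ : α ≢ τ
            α≢τ = λ { refl → mt₁ r (flip χ pτ₁) }
            -- Both ends of `r t` now miss `α`, so this edge alone is a whole chain of `α` and `τ`.
            -- The vertex `v` is off it and can be made to miss `τ`; then `t` is restored to miss
            -- `δ`.
            lrt : Link χ α τ r t
            lrt = inj₂ pτ₁ ◅ ε
            nlv : ¬ Link χ α τ r v
            nlv = λ l' → vt (three χ α≢τ (inj₁ (missR s₁)) (inj₁ mv₁) (inj₁ mt₁) l' lrt vr (≢-sym rt))
            τ≢δ : τ ≢ δ
            τ≢δ = λ { refl → mt r (flip ψ pτ) }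
        in flipA s₁ nlv λ χ₂ K₂ s₂ nr₂ →
        let nt₂ : ¬ Link χ α τ v t
            nt₂ = λ l' → nlv (lrt ◅◅ linkSym χ l')
            mt₂ = Swapped.outMiss K₂ nt₂ mt₁
            mv₂ = Swapped.missA K₂ ε mv₁
            M₂ = swapPath K₂ nr₂ (λ { (_ , a , _ , b) → a , b }) M₁
            q₂ = trans (Swapped.colOut K₂ nr₂ v) q₁
            pτ₂ = trans (Swapped.colOut K₂ nr₂ t) pτ₁
            p₂ = flip χ₂ (trans (Swapped.colOut K₂ nt₂ x) (flip χ p₁))
            offt₂ = off s₂ (≢-sym rt) tx (inj₁ mt₂)
        in flipA s₂ offt₂ λ χ₃ K₃ s₃ nr₃ →
           noPathτ s₃ (Swapped.missA K₃ ε mt₂) (trans (Swapped.colOut K₃ (xOff s₂ offt₂) t) p₂) (trans (Swapped.colOut K₃ nr₃ t) pτ₂)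
             (snoc (mapPath (λ { _ a b (c , _) → a , b , c }) (swapPath K₃ nr₃ (λ { (_ , a , b , _) → a , b }) M₂)) v
               (trans (Swapped.colOut K₃ nr₃ v) q₂) (Swapped.missOther K₃ (≢-sym α≢τ) τ≢δ mv₂) vt)

    -- Whichever way `orient` turns out, before or after the toggle a fan runs from the colour of
    -- `x t` to the colour missing at `t`.
    commonβ : ∀ {φ α β t} → State φ α β → adj r t ≡ true → adj x t ≡ true → Miss φ t β → ⊥
    commonβ {φ} {t = t} s ar adjXW mt with colX s adjXW (≢-sym (rt s ar))
      where
      rt : ∀ {φ α β} → State φ α β → adj r t ≡ true → r ≢ t
      rt s a refl with trans (sym (SimpleGraph.irrefl G r)) a
      ... | ()
    ... | γ , p with toggle s mt p
    ...   | ψ , U , s' , mt' , p' = orient s mt p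
      (λ L → fanCommon s' ar mt' p' (togglePath s U (r≢ s p) (λ q → q) L))
      (λ ψ₁ U₁ s₁ m₁ p₁ L → fanCommon s ar mt p (togglePath⁻ s₁ U₁ (r≢ s p) (λ q → q) L))

    adj≢ : ∀ {u v} → adj u v ≡ true → u ≢ v
    adj≢ {u} a refl with trans (sym (SimpleGraph.irrefl G u)) a
    ... | ()

    commonα : ∀ {φ α β t} → State φ α β → adj r t ≡ true → adj x t ≡ true → Miss φ t α → ⊥
    commonα {t = t} s ar adjXW mt = flipA s (off s (≢-sym (adj≢ ar)) (≢-sym (adj≢ adjXW)) (inj₁ mt)) λ χ K s₁ _ →
      commonβ s₁ ar adjXW (Swapped.missA K ε mt)

    commonLink : ∀ {φ α β t c} → State φ α β → adj r t ≡ true → adj x t ≡ true → Miss φ t c → ¬ ¬ Link φ α c r t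
    commonLink s ar adjXW mt nl = flipA s nl λ χ K s₁ _ → commonα s₁ ar adjXW (Swapped.missB K ε mt)

    privatePath : ∀ {φ α β w c d} → State φ α β → adj r w ≡ false → FreeFanPath φ r c d → FanPath φ r (avoids w) c d
    privatePath {w = w} s pw = mapPath λ L p m _ → p , m , λ { refl → absurd (OneHole.on (holeRX s) p) }
      where
      absurd : adj r w ≡ true → ⊥
      absurd a with trans (sym pw) a
      ... | ()

    togglePrivatePath : ∀ {φ ψ α β w m c d} → State φ α β → adj r w ≡ false → r ≢ w → Recoloured φ ψ x w m → FreeFanPath φ r c d → FreeFanPath ψ r c d
    togglePrivatePath s pw rw U L = forget (togglePath s U rw (λ q → q) (privatePath s pw L))

    -- A fan from `β` hands over neither `α` nor `β`, so it is immune to these changes away from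
    -- `r`.
    keepPath : ∀ {φ ψ α β v c d} → State φ α β → Swapped φ ψ α β v → ¬ Link φ α β v r → FreeFanPath φ r β c → FreeFanPath φ r c d → FreeFanPath ψ r c d
    keepPath s K nl L = mapPath λ M p m _ → trans (Swapped.colOut K nl _) p ,
      Swapped.missOther K (λ { refl → F.noA s (snoc (concatPath L M) _ p m tt) }) (λ { refl → F.fanHole s (reached (concatPath L M) p m) (missX s) }) m , tt

    Differ : PartialColouring → C → C → V → V → Set
    Differ φ a b p q = (Miss φ p a × Miss φ q b) ⊎ (Miss φ p b × Miss φ q a)

    -- Decides which of `p` and `q` misses `α`, at no cost: the edges at `x` and the fans from `β`
    -- stay as they are.
    arrange : ∀ {φ α β p q} → State φ α β → p ≢ r → p ≢ x → q ≢ r → q ≢ x → Differ φ α β p q →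
      (∀ ψ → State ψ α β → Miss ψ p α → Miss ψ q β → (∀ w → col ψ x w ≡ col φ x w) →
        (∀ {c d} → FreeFanPath φ r β c → FreeFanPath φ r c d → FreeFanPath ψ r c d) → ⊥) → ⊥
    arrange s notAdjR px qr qx (inj₁ (a , b)) f = f _ s a b (λ _ → refl) (λ _ L → L)
    arrange {φ} {α} {β} {p} {q} s notAdjR px qr qx (inj₂ (a , b)) f = splitLink φ α β q p
      (λ l → flipA s offq λ χ K s₁ nr → f χ s₁ (Swapped.missB K l a) (Swapped.missA K ε b) (Swapped.colOut K (xOff s offq)) (keepPath s K nr))
      λ nl → flipA s offq λ χ K s₁ nr →
        let mp = Swapped.outMiss K nl a
            offp = off s₁ notAdjR px (inj₂ mp)
        in flipA s₁ offp λ χ₂ K₂ s₂ nr₂ → f χ₂ s₂ (Swapped.missB K₂ ε mp)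
          (Swapped.outMiss K₂ (λ l → nl (linkSym φ (Swapped.link⁻ K l))) (Swapped.missA K ε b))
          (λ w → trans (Swapped.colOut K₂ (xOff s₁ offp) w) (Swapped.colOut K (xOff s offq) w))
          (λ L M → keepPath s₁ K₂ nr₂ (keepPath s K nr nil L) (keepPath s K nr L M))
      where
      offq = off s qr qx (inj₁ b)

    -- The two bad vertices toggle x through both of their colours, which the fan then carries to r.
    twoOnFan : ∀ {φ α β p q γ κ} → State φ α β → p ≢ q → adj r p ≡ false → adj r q ≡ false → Differ φ α β p q →
      col φ x p ≡ just γ → col φ x q ≡ just κ → FreeFanPath φ r β γ → FreeFanPath φ r γ κ → ⊥
    twoOnFan {φ₀} {p = p} {q} s₀ pq pp pq' dif cp₀ cq₀ L₀ M₀ =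
      arrange s₀ (≢-sym (r≢ s₀ cp₀)) (≢-sym (coloured⇒≢ φ₀ cp₀)) (≢-sym (r≢ s₀ cq₀)) (≢-sym (coloured⇒≢ φ₀ cq₀)) dif
        λ φ s mp mq cx ld → go φ s mp mq (trans (cx p) cp₀) (trans (cx q) cq₀) (ld nil L₀) (ld L₀ M₀)
      where
      go : ∀ φ {α β γ κ} → State φ α β → Miss φ p α → Miss φ q β → col φ x p ≡ just γ → col φ x q ≡ just κ →
        FreeFanPath φ r β γ → FreeFanPath φ r γ κ → ⊥
      go φ {α} {β} {γ} {κ} s mp mq cp cq L M with first (λ e → e ≟ κ) (privatePath s pq' M) | toggle s mq cq
      ... | inj₁ nil | _ = pq (colProper φ cp cq)
      ... | inj₁ (snoc _ _ _ _ (_ , ne)) | _ = ne refl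
      ... | inj₂ (f , t , .κ , N , pt , mt , tq , refl) | ψ , U , s' , mq' , cq' =
        -- After toggling `x q`, both `x` and `t` miss `κ`. The aim is that `t` misses `α` and `p`
        -- misses `κ`: one change does both if they share a chain, otherwise each gets its own.
        -- Toggling `x p` then makes `γ` missing at `x`, and its fan reaches `α` through `t`.
        flipA s' offt λ χ K s₁ nr → splitLink ψ α κ t p
          (λ l → finish s₁ (Swapped.missB K ε mt') (Swapped.missA K l mp') (trans (Swapped.colOut K (xOff s' offt) p) cp')
            (trans (Swapped.colOut K nr t) pt') (swapPath K nr (λ { (_ , a , b) → a , b }) N'))
          λ nl →
            let mp₁ = Swapped.outMiss K nl mp'
                offp = off s₁ notAdjR px (inj₁ mp₁)
            in flipA s₁ offp λ χ₂ K₂ s₂ nr₂ →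
              finish s₂ (Swapped.outMiss K₂ (λ l → nl (linkSym ψ (Swapped.link⁻ K l))) (Swapped.missB K ε mt')) (Swapped.missA K₂ ε mp₁)
                (trans (Swapped.colOut K₂ (xOff s₁ offp) p) (trans (Swapped.colOut K (xOff s' offt) p) cp'))
                (trans (Swapped.colOut K₂ nr₂ t) (trans (Swapped.colOut K nr t) pt'))
                (swapPath K₂ nr₂ (λ { (_ , a , b) → a , b }) (swapPath K nr (λ { (_ , a , b) → a , b }) N'))
        where
        notAdjR = ≢-sym (r≢ s cp)
        px = ≢-sym (coloured⇒≢ φ cp)
        xq = coloured⇒≢ φ cq
        Q : V → C → Set
        Q u e = u ≢ q × e ≢ α × e ≢ κ
        N' : FanPath ψ r Q γ f
        N' = togglePath s U (r≢ s cq) proj₁ (mapPath (λ { X a b (c , ne) → a , b , c ,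
          (λ { refl → F.noA s (concatPath L (snoc (forget X) _ a b tt)) }) , ne }) N)
        pt' = trans (Recoloured.away U (OneHole.r≢z (holeRX s)) (r≢ s cq) t) pt
        mt' = Recoloured.awayMiss U (x≢ s pt) tq mt
        mp' = Recoloured.awayMiss U px pq mp
        cp' = trans (Recoloured.atP U xq pq) cp
        offt = off s' (λ { refl → coloured⇒≢ φ pt refl }) (x≢ s pt) (inj₂ mt')
        finish : ∀ {χ} → State χ α κ → Miss χ t α → Miss χ p κ → col χ x p ≡ just γ → col χ r t ≡ just f →
          FanPath χ r Q γ f → ⊥
        finish s₁ mt₁ mp₁ cp₁ pt₁ N₁ with toggle s₁ mp₁ cp₁
        ... | ψ₂ , U₂ , s₂ , _ , _ = F.noA s₂ (togglePrivatePath s₁ pp (r≢ s₁ cp₁) U₂ (snoc (forget N₁) t pt₁ mt₁ tt))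

    -- Applying `orient` to `q` puts `β`, `γ` and `κ` in a linear order along one fan, and each
    -- possible order is an instance of `twoOnFan`.
    twoBad′ : ∀ {φ α β p q γ κ} → State φ α β → p ≢ q → adj r p ≡ false → adj r q ≡ false → Differ φ α β p q →
      col φ x p ≡ just γ → col φ x q ≡ just κ → FreeFanPath φ r β γ → ⊥
    twoBad′ {φ₀} {p = p} {q} s₀ pq pp pq' dif cp₀ cq₀ L₀ =
      arrange s₀ (≢-sym (r≢ s₀ cp₀)) (≢-sym (coloured⇒≢ φ₀ cp₀)) (≢-sym (r≢ s₀ cq₀)) (≢-sym (coloured⇒≢ φ₀ cq₀)) dif
        λ φ s mp mq cx ld → go φ s mp mq (trans (cx p) cp₀) (trans (cx q) cq₀) (ld nil L₀)
      where
      go : ∀ φ {α β γ κ} → State φ α β → Miss φ p α → Miss φ q β → col φ x p ≡ just γ → col φ x q ≡ just κ → FreeFanPath φ r β γ → ⊥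
      go φ s mp mq cp cq L = orient s mq cq
        (λ M → [ (λ X → twoOnFan s pq pp pq' (inj₁ (mp , mq)) cp cq L X)
               , (λ X → twoOnFan s (≢-sym pq) pq' pp (inj₂ (mq , mp)) cq cp (forget M) X) ]′
               (compare nc (λ z → uniqueMissingNbr s z) L (forget M)))
        λ ψ U s' mq' cq' M → twoOnFan s' (≢-sym pq) pq' pp
          (inj₂ (mq' , Recoloured.awayMiss U (≢-sym (coloured⇒≢ φ cp)) pq mp)) cq' (trans (Recoloured.atP U (coloured⇒≢ φ cq) pq) cp)
          (forget M) (togglePrivatePath s pq' (r≢ s cq) U L)

    -- Applying `orient` to `p` provides the fan that `twoBad′` asks for, before or after toggling
    -- `x p`.
    twoBad : ∀ {φ α β p q} → State φ α β → p ≢ q → adj x p ≡ true → adj x q ≡ true → p ≢ r → q ≢ r →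
      adj r p ≡ false → adj r q ≡ false → Differ φ α β p q → ⊥
    twoBad {φ₀} {p = p} {q} s₀ pq ap aq notAdjR qr pp pq' dif =
      arrange s₀ qr (≢-sym (adj≢ aq)) notAdjR (≢-sym (adj≢ ap)) (turnD dif) λ φ s mq mp cx ld → go φ s mq mp
      where
      turnD : ∀ {a b} → Differ φ₀ a b p q → Differ φ₀ a b q p
      turnD (inj₁ (a , b)) = inj₂ (b , a)
      turnD (inj₂ (a , b)) = inj₁ (b , a)
      go : ∀ φ {α β} → State φ α β → Miss φ q α → Miss φ p β → ⊥
      go φ s mq mp with colX s ap notAdjR | colX s aq qr
      ... | γ , cp | κ , cq = orient s mp cp
        (λ L → twoBad′ s pq pp pq' (inj₂ (mp , mq)) cp cq (forget L))
        λ ψ U s' mp' cp' L → twoBad′ s' pq pp pq'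
          (inj₂ (mp' , Recoloured.awayMiss U (≢-sym (adj≢ aq)) (≢-sym pq) mq)) cp' (trans (Recoloured.atP U (adj≢ ap) (≢-sym pq)) cq) (forget L)

    γ≢α : ∀ {φ α β w γ} → State φ α β → Miss φ w β → col φ x w ≡ just γ → α ≢ γ
    γ≢α s missW p = α≢β (proj₁ (proj₂ (proj₂ (toggle s missW p))))

    -- The colour missing at a common neighbour c is used as a spare colour to move β away from w.
    shortFan : ∀ {φ α β γ t w c} → State φ α β → t ≢ c → w ≢ c → t ≢ w → col φ r t ≡ just β → Miss φ t γ → col φ x w ≡ just γ →
      Miss φ w β → adj r c ≡ true → adj x c ≡ true → IsSubcore c → ⊥
    shortFan {φ} {α} {β} {γ} {t} {w} {c} s tc wc tw pt mt colXW missW ar adjXW dc with Counts.missing (holeRX s) {c} (subst (deg G c <_) dc (ℕ.n<1+n _))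
    ... | κ , mc = flipA s offw λ χ₁ K₁ s₁ nr₁ →
      let mw₁ = Swapped.missB K₁ ε missW
          mc₁ = Swapped.missOther K₁ κ≢α κ≢β mc
          mt₁ = Swapped.missOther K₁ (≢-sym α≢γ) γ≢β mt
          pt₁ = trans (Swapped.colOut K₁ nr₁ t) pt
          cw₁ = trans (Swapped.colOut K₁ (xOff s offw) w) colXW
      in commonLink s₁ ar adjXW mc₁ λ lrc →
      let nlw = λ l → wc (sym (three χ₁ (≢-sym κ≢α) (inj₁ (missR s₁)) (inj₂ mc₁) (inj₁ mw₁) lrc l cr w≢r))
      in flipA s₁ nlw λ χ₂ K₂ s₂ nr₂ →
      part₂ s₂ (trans (Swapped.colOut K₂ nr₂ t) pt₁) (Swapped.missOther K₂ (≢-sym α≢γ) (≢-sym κ≢γ) mt₁)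
        (Swapped.keepOther K₂ (≢-sym α≢γ) (≢-sym κ≢γ) cw₁) (Swapped.missA K₂ ε mw₁)
        (Swapped.outMiss K₂ (λ l → nlw (lrc ◅◅ linkSym χ₁ l)) mc₁)
      where
      cr = ≢-sym (adj≢ ar)
      w≢r = ≢-sym (r≢ s colXW)
      wx = ≢-sym (coloured⇒≢ φ colXW)
      tr' : t ≢ r
      tr' = ≢-sym (coloured⇒≢ φ pt)
      κ≢α : κ ≢ α
      κ≢α refl = commonα s ar adjXW mc
      κ≢β : κ ≢ β
      κ≢β refl = commonβ s ar adjXW mc
      α≢γ = γ≢α s missW colXW
      γ≢β : γ ≢ β
      γ≢β refl = missX s w colXW
      κ≢γ : κ ≢ γ
      κ≢γ refl with toggle s missW colXW
      ... | ψ , U , s' , _ , _ = commonβ s' ar adjXW (Recoloured.awayMiss U (≢-sym (adj≢ adjXW)) (≢-sym wc) mc)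
      offw = off s w≢r wx (inj₂ missW)
      free : ∀ {χ} → State χ α β → col χ r t ≡ just β → Miss χ t κ → ¬ Link χ α κ r t → ⊥
      free s₁ pt₁ mt₁ nl = flipA s₁ nl λ χ K s₂ nr → F.noA s₂ (snoc nil t (trans (Swapped.colOut K nr t) pt₁) (Swapped.missB K ε mt₁) tt)
      part₂ : ∀ {χ} → State χ α β → col χ r t ≡ just β → Miss χ t γ → col χ x w ≡ just γ → Miss χ w κ → Miss χ c κ → ⊥
      -- By now both `w` and `c` miss `κ`, and the change at `t` makes `t` miss `κ` too. If `t` is
      -- off the chain of `r` with colours `α` and `κ`, it can be made to miss `α` and `free`
      -- applies. Otherwise `c` has come to miss `γ`, and `w` is led back to `β` by way of `α`;
      -- toggling `x w` makes `c` a common neighbour that misses the colour of `x`.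
      part₂ {χ} s₂ pt₂ mt₂ cw₂ mw₂ mc₂ = swapComponent χ κ γ t λ χ₃ K →
        let s₃ = state (holeSwapped K (holeRX s₂)) (Swapped.missOther K (≢-sym κ≢α) α≢γ (missR s₂)) (Swapped.missOther K (≢-sym κ≢β) (≢-sym γ≢β) (missX s₂))
            pt₃ = Swapped.keepOther K (≢-sym κ≢β) (≢-sym γ≢β) pt₂
            mt₃ = Swapped.missB K ε mt₂
        in splitLink χ κ γ t c
          (λ l →
            let nw = λ l' → wc (sym (three χ κ≢γ (inj₂ mt₂) (inj₁ mc₂) (inj₁ mw₂) l l' (≢-sym tc) (≢-sym tw)))
                mw₃ = Swapped.outMiss K nw mw₂
                cw₃ = flip χ₃ (trans (Swapped.colOut K nw x) (flip χ cw₂))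
                mc₃ = Swapped.missA K l mc₂
            in splitLink χ₃ α κ r t
              (λ lrt →
                let nrw = λ l' → tw (three χ₃ (≢-sym κ≢α) (inj₁ (missR s₃)) (inj₂ mt₃) (inj₂ mw₃) lrt l' tr' w≢r)
                in flipA s₃ nrw λ χ₄ K₄ s₄ nr₄ →
                let mw₄ = Swapped.missB K₄ ε mw₃
                    mc₄ = Swapped.missOther K₄ (≢-sym α≢γ) (≢-sym κ≢γ) mc₃
                    cw₄ = Swapped.keepOther K₄ (≢-sym α≢γ) (≢-sym κ≢γ) cw₃
                    off₄ = off s₄ w≢r wx (inj₁ mw₄)
                in flipA s₄ off₄ λ χ₅ K₅ s₅ nr₅ →
                  last s₅ (Swapped.missA K₅ ε mw₄) (trans (Swapped.colOut K₅ (xOff s₄ off₄) w) cw₄) (Swapped.missOther K₅ (≢-sym α≢γ) γ≢β mc₄))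
              (free s₃ pt₃ mt₃))
          λ nl → let mc₃ = Swapped.outMiss K nl mc₂ in commonLink s₃ ar adjXW mc₃ λ lrc →
            free s₃ pt₃ mt₃ λ l → tc (three χ₃ (≢-sym κ≢α) (inj₁ (missR s₃)) (inj₂ mt₃) (inj₂ mc₃) l lrc tr' cr)
        where
        last : ∀ {χ} → State χ α β → Miss χ w β → col χ x w ≡ just γ → Miss χ c γ → ⊥
        last s₅ m₅ c₅ mc₅ with toggle s₅ m₅ c₅
        ... | ψ , U , s' , _ , _ = commonβ s' ar adjXW (Recoloured.awayMiss U (≢-sym (adj≢ adjXW)) (≢-sym wc) mc₅)

-- Sets with a few elements removed

minus : ∀ {m} → Subset m → List (Fin m) → Subset m
minus p [] = p
minus p (x ∷ xs) = minus p xs - x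

∈minus : ∀ {m} (p : Subset m) L {v} → v ∈ minus p L → v ∈ p × All (v ≢_) L
∈minus p [] h = h , []
∈minus p (x ∷ L) h with ∈minus p L (p─q⊆p (minus p L) _ h)
... | a , b = a , (λ { refl → x∉p-x (minus p L) x h }) ∷ b

∣minus∣ : ∀ {m} (p : Subset m) L → ∣ p ∣ ≤ ∣ minus p L ∣ + length L
∣minus∣ p [] = ℕ.≤-reflexive (sym (ℕ.+-identityʳ _))
∣minus∣ p (x ∷ L) = ℕ.≤-trans (∣minus∣ p L)
  (ℕ.≤-trans (ℕ.+-monoˡ-≤ (length L) (∣p∣≤1+∣p-x∣ (minus p L) x)) (ℕ.≤-reflexive (sym (ℕ.+-suc _ _))))

pick : ∀ {m} (p : Subset m) → 1 ≤ ∣ p ∣ → ∃ λ v → v ∈ p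
pick (inside ∷ p) _ = zero , here
pick (outside ∷ p) le with pick p le
... | v , h = suc v , there h

-- Neighbours of only one end of a core edge

module CoreEdges {n : ℕ} (k : ℕ) (G : SimpleGraph n) (deg≤ : ∀ v → deg G v ≤ k)
  (core≤2 : ∀ v → deg G v ≡ k → ∣ Nd G k v ∣ ≤ 2)
  (nc : Moves.Graph.NonCol n k G)
  (crit : ∀ {u v} → SimpleGraph.adj G u v ≡ true → (∀ φ → Moves.Graph.OneHole n k G φ u v → ⊥) → ⊥)
  (5≤k : 5 ≤ k) where

  open CriticalGraph k G deg≤ core≤2 nc crit public
  open SimpleGraph G using (adj)

  notBoth : ∀ {u v : V} → adj u v ≡ true → adj u v ≡ false → ⊥
  notBoth a b with trans (sym a) b
  ... | ()

  subcore≢core : ∀ {v w} → IsSubcore v → IsCore w → v ≢ w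
  subcore≢core d t refl = ℕ.<-irrefl (trans t (sym d)) (ℕ.n<1+n _)

  subcoreExceptTwo : ∀ {r x} → IsCore r → IsCore x → adj r x ≡ true →
    (∀ y → (∀ v → adj r v ≡ true → v ≢ x → v ≢ y → IsSubcore v) → ⊥) → ⊥
  subcoreExceptTwo {r} {x} rT xT a f = Crit.anotherCore a λ y ay yx yT → f y λ v av vx vy →
    [ (λ vT → ⊥-elim (Crit.threeCore rT a ay av xT yT vT (≢-sym yx) (≢-sym vx) (≢-sym vy))) , (λ d → d) ]′ (coreOrSubcore rT av)

  -- The source of the bound 5: two core neighbours and two vertices already chosen must leave a
  -- third choice.
  threeSubcore : ∀ {r x} → IsCore r → IsCore x → adj r x ≡ true →
    (∀ d₁ d₂ d₃ → adj r d₁ ≡ true → adj r d₂ ≡ true → adj r d₃ ≡ true → IsSubcore d₁ → IsSubcore d₂ → IsSubcore d₃ →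
      d₁ ≢ d₂ → d₁ ≢ d₃ → d₂ ≢ d₃ → ⊥) → ⊥
  threeSubcore {r} {x} rT xT a f = subcoreExceptTwo rT xT a λ y isd →
    let get : ∀ L → length L ≤ 2 → ∃ λ v → adj r v ≡ true × IsSubcore v × All (v ≢_) L
        get L le = let (v , h) = pick (minus (N G r) (x ∷ y ∷ L)) (room L le)
                       (h₁ , vs) = ∈minus (N G r) (x ∷ y ∷ L) h
                   in v , N∈ G h₁ , isd v (N∈ G h₁) (All.head vs) (All.head (All.tail vs)) , All.tail (All.tail vs)
        (d₁ , a₁ , i₁ , _) = get [] z≤n
        (d₂ , a₂ , i₂ , n₂) = get (d₁ ∷ []) (s≤s z≤n)
        (d₃ , a₃ , i₃ , n₃) = get (d₁ ∷ d₂ ∷ []) (s≤s (s≤s z≤n))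
    in f d₁ d₂ d₃ a₁ a₂ a₃ i₁ i₂ i₃ (≢-sym (All.head n₂)) (≢-sym (All.head n₃)) (≢-sym (All.head (All.tail n₃)))
    where
    room : ∀ {y} L → length L ≤ 2 → 1 ≤ ∣ minus (N G r) (x ∷ y ∷ L) ∣
    room {y} L le = ℕ.+-cancelʳ-≤ 4 1 _ (ℕ.≤-trans 5≤k (ℕ.≤-trans (ℕ.≤-reflexive (sym rT))
      (ℕ.≤-trans (∣minus∣ (N G r) (x ∷ y ∷ L)) (ℕ.+-monoʳ-≤ _ (s≤s (s≤s le))))))

  module PrivateVertex (r x : V) (rT : IsCore r) (xT : IsCore x) where
    open Pair r x rT xT
    open State
    module R = Pair x r xT rT

    turned : ∀ {φ α β} → State φ α β → R.State φ β α
    turned s = R.state (holeSym (holeRX s)) (missX s) (missR s)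

    rx : ∀ {φ α β} → State φ α β → adj r x ≡ true
    rx s = OneHole.edge (holeRX s)

    OnX OnR : V → Set
    OnX v = adj x v ≡ true × IsSubcore v
    OnR v = adj r v ≡ true × IsSubcore v

    missingAt : ∀ {φ α β v} → State φ α β → IsSubcore v → ∃ (Miss φ v)
    missingAt {v = v} s d = Counts.missing (holeRX s) (subst (deg G v <_) d (ℕ.n<1+n _))

    -- Otherwise the neighbours of x of degree k - 1 outside ws, at least k - 2 - |ws| many, would miss
    -- distinct colours outside c, α, β and L.
    cover : ∀ {φ α β} → State φ α β → (ws : List V) (L : List C) → length ws ≡ length L → ∀ {c} → Distinct (c ∷ α ∷ β ∷ L) →
      (∀ v e → OnX v → All (v ≢_) ws → Miss φ v e → All (e ≢_) (α ∷ β ∷ L)) →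
      (∀ v v' e → OnX v → OnX v' → All (v ≢_) ws → All (v' ≢_) ws → v ≢ v' → Miss φ v e → Miss φ v' e → ⊥) →
      (∀ v → OnX v → All (v ≢_) ws → Miss φ v c → ⊥) → ⊥
    cover {φ} {α} {β} s ws L eq {c} d nb inj f = subcoreExceptTwo xT rT (adjSym (rx s)) λ z isd →
      let p = minus (N G x) (r ∷ z ∷ ws)
          on : ∀ v → v ∈ p → OnX v × All (v ≢_) ws
          on v h = let (h₁ , vs) = ∈minus (N G x) (r ∷ z ∷ ws) h
                   in (N∈ G h₁ , isd v (N∈ G h₁) (All.head vs) (All.head (All.tail vs))) , All.tail (All.tail vs)
          m : ∀ v h → ∃ (Miss φ v)
          m v h = missingAt s (proj₂ (proj₁ (on v h)))
      in ℕ.<-irrefl refl (ℕ.≤-trans (s≤s (ℕ.≤-trans (ℕ.≤-reflexive (sym xT)) (∣minus∣ (N G x) (r ∷ z ∷ ws))))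
           (ℕ.≤-trans (ℕ.≤-reflexive (trans (cong (λ l → suc (∣ p ∣ + suc (suc l))) eq) (sym (ℕ.+-suc ∣ p ∣ _))))
             (avoid p (c ∷ α ∷ β ∷ L) d (λ v h → proj₁ (m v h))
               (λ v h → (λ { e → f v (proj₁ (on v h)) (proj₂ (on v h)) (subst (Miss φ v) e (proj₂ (m v h))) })
                   ∷ nb v _ (proj₁ (on v h)) (proj₂ (on v h)) (proj₂ (m v h)))
               λ v v' h h' e → eqV v v' λ ne → inj v v' _ (proj₁ (on v h)) (proj₁ (on v' h')) (proj₂ (on v h)) (proj₂ (on v' h')) ne
                 (proj₂ (m v h)) (subst (Miss φ v') (sym e) (proj₂ (m v' h'))))))
      where
      eqV : ∀ v v' → ¬ (v ≢ v') → v ≡ v'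
      eqV v v' q with v ≟ v'
      ... | yes e = e
      ... | no ne = ⊥-elim (q ne)

    splitAdj : ∀ {u v : V} → (adj u v ≡ true → ⊥) → (adj u v ≡ false → ⊥) → ⊥
    splitAdj {u} {v} f g with adj u v in eq
    ... | true = f refl
    ... | false = g refl

    record Bad (φ : PartialColouring) (α β : C) (w : V) (γ : C) : Set where
      constructor bad
      field
        adjXW : adj x w ≡ true
        notAdjR : adj r w ≡ false
        w≢r : w ≢ r
        missW : Miss φ w β
        colXW : col φ x w ≡ just γ

    open Bad

    onR : ∀ {φ α β v c} → State φ α β → col φ r v ≡ just c → adj r v ≡ true
    onR s p = OneHole.on (holeRX s) p

    -- A common neighbour is excluded by `commonα`; any other `v` forms with `w` a pair as in
    -- `twoBad`.
    noBadα : ∀ {φ α β w γ v} → State φ α β → Bad φ α β w γ → OnX v → v ≢ w → Miss φ v α → ⊥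
    noBadα {w = w} s b (av , dv) vw m = splitAdj (λ ar → commonα s ar av m) λ pv →
      twoBad s vw av (adjXW b) (subcore≢core dv rT) (w≢r b) pv (notAdjR b) (inj₁ (m , missW b))

    -- Otherwise `v` could be changed to miss `α` while `w` keeps missing `β`.
    linkβ : ∀ {φ α β w γ v} → State φ α β → Bad φ α β w γ → OnX v → v ≢ w → Miss φ v β → ¬ ¬ Link φ α β w v
    linkβ {φ} s b (av , dv) vw m nl = flipA s (off s (subcore≢core dv rT) (subcore≢core dv xT) (inj₂ m)) λ χ K s₁ nr →
      noBadα s₁ (bad (adjXW b) (notAdjR b) (w≢r b) (Swapped.outMiss K (λ l → nl (linkSym φ l)) (missW b))
        (trans (Swapped.colOut K (xOff s (off s (subcore≢core dv rT) (subcore≢core dv xT) (inj₂ m))) _) (colXW b))) (av , dv) vw (Swapped.missB K ε m)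

    linkX : ∀ {φ α β w γ v c} → State φ α β → Bad φ α β w γ → OnX v → v ≢ w → c ≢ α → c ≢ β → Miss φ v c → ¬ ¬ Link φ α c r v
    linkX {φ} {γ = γ} s b (av , dv) vw ca cb m nl = flipA s nl λ χ K s₁ nr →
      let mw₁ = Swapped.missOther K (≢-sym (α≢β s)) (≢-sym cb) (missW b)
          (γ' , cw') = Swapped.coloured⁺ K (colXW b)
      in noBadα s₁ (bad (adjXW b) (notAdjR b) (w≢r b) mw₁ cw') (av , dv) vw (Swapped.missB K ε m)

    apartX : ∀ {φ α β w γ v v' c} → State φ α β → Bad φ α β w γ → OnX v → OnX v' → v ≢ w → v' ≢ w → v ≢ v' → c ≢ α → c ≢ β →
      Miss φ v c → Miss φ v' c → ⊥
    apartX {φ} s b ov ov' vw vw' ne ca cb m m' = linkX s b ov vw ca cb m λ l → linkX s b ov' vw' ca cb m' λ l' →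
      ne (three φ (≢-sym ca) (inj₁ (missR s)) (inj₂ m) (inj₂ m') l l' (subcore≢core (proj₂ ov) rT) (subcore≢core (proj₂ ov') rT))

    separate : ∀ {u v v' : V} → adj u v ≡ true → adj u v' ≡ false → v ≢ v'
    separate a p refl = notBoth a p

    -- The chain from `r` already ends at `v`, so `t` lies off it and can be changed to miss `α`.
    freeT : ∀ {φ α β w γ v t c} → State φ α β → Bad φ α β w γ → OnX v → v ≢ w → OnR t → adj x t ≡ false → c ≢ α → c ≢ β →
      Miss φ v c → Miss φ t c →
      (∀ ψ → Swapped φ ψ α c t → State ψ α β → ¬ Link φ α c t r → Miss ψ t α → ⊥) → ⊥
    freeT {φ} s b ov vw ot pt ca cb m mt f = linkX s b ov vw ca cb m λ l → flipA s
      (λ l' → separate (proj₁ ov) pt (three φ (≢-sym ca) (inj₁ (missR s)) (inj₂ m) (inj₂ mt) l l' (subcore≢core (proj₂ ov) rT) (subcore≢core (proj₂ ot) rT)))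
      λ χ K s₁ nr → f χ K s₁ nr (Swapped.missB K ε mt)

    -- Otherwise a change at `t` lets the fan arrive at `α`, with `w` still available for toggling.
    pathEndLinked : ∀ {φ α δ w β f t} → State φ α δ → Miss φ w δ → col φ x w ≡ just β → FanPath φ r (avoids w) β f →
      col φ r t ≡ just f → Miss φ t δ → t ≢ w → ¬ ¬ Link φ α δ t w
    pathEndLinked {φ} {w = w} {t = t} s missW colXW L p m tw nl = flipA s offt λ χ K s₁ nr →
      noPathα s₁ (Swapped.outMiss K nl missW) (trans (Swapped.colOut K (xOff s offt) w) colXW)
        ([ (λ X → snoc X t (trans (Swapped.colOut K nr t) p) (Swapped.missB K ε m) tw) , (λ X → X) ]′
          (swapPathOrHit nc {Q = avoids w} (λ z → z) K nr (noPathα s missW colXW) L))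
      where
      offt = off s (λ { refl → coloured⇒≢ φ p refl }) (x≢ s p) (inj₂ m)

    -- the vertex at which the fan at r starting with β first arrives at the colour γ of xw
    record Meets (φ : PartialColouring) (w : V) (β γ : C) : Set where
      constructor meets
      field
        {tip} : C
        t : V
        ld : FanPath φ r (λ v e → avoids w v e × e ≢ γ) β tip
        arc : col φ r t ≡ just tip
        gap : Miss φ t γ
        tw : t ≢ w

    meetsAtγ : ∀ {φ α β w γ} → State φ α β → Bad φ α β w γ → FanPath φ r (avoids w) β γ → Meets φ w β γ
    meetsAtγ {γ = γ} s b L with first (λ e → e ≟ γ) L
    ... | inj₁ nil = ⊥-elim (missX s _ (colXW b))
    ... | inj₁ (snoc _ _ _ _ (_ , ne)) = ⊥-elim (ne refl)
    ... | inj₂ (f , v , _ , M , p , m , vw , refl) = meets v M p m vw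

    module _ {φ α β w γ} (s : State φ α β) (b : Bad φ α β w γ) (mt : Meets φ w β γ) where
      open Meets mt
      private
        T = toggle s (missW b) (colXW b)
        ψ = proj₁ T
        U = proj₁ (proj₂ T)
        s' = proj₁ (proj₂ (proj₂ T))
        mw' = proj₁ (proj₂ (proj₂ (proj₂ T)))
        cw' = proj₂ (proj₂ (proj₂ (proj₂ T)))
        rw = r≢ s (colXW b)
        gap' : Miss ψ t γ
        gap' = Recoloured.awayMiss U (x≢ s arc) tw gap

      joined : ¬ ¬ Link ψ α γ t w
      joined = pathEndLinked s' mw' cw' (togglePath s U rw (λ q → q) (mapPath (λ { _ a b (c , _) → a , b , c }) ld))
        (trans (Recoloured.away U (OneHole.r≢z (holeRX s)) rw t) arc) gap' tw

      tPriv : adj x t ≡ true → ⊥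
      tPriv a = commonβ s' (onR s arc) a gap'

      -- After the toggle the chain between `t` and `w` has both its ends. If `v` is not adjacent to
      -- `r`, it can therefore be made to miss `α` without disturbing `w`, which `twoBad` forbids.
      noγ : ∀ {v} → OnX v → v ≢ w → Miss φ v γ → ⊥
      noγ {v} (av , dv) vw m = splitAdj (λ ar → commonβ s' ar av m') λ pv →
        joined λ l → let nl = λ l' → vt pv (sym (three ψ (α≢β s') (inj₂ mw') (inj₂ gap') (inj₂ m') (linkSym ψ l) l' tw vw))
                         offv = off s' (subcore≢core dv rT) (subcore≢core dv xT) (inj₂ m')
                     in flipA s' offv λ χ K s₁ nr →
          twoBad s₁ vw av (adjXW b) (subcore≢core dv rT) (w≢r b) pv (notAdjR b)
            (inj₁ (Swapped.missB K ε m' , Swapped.outMiss K (λ l' → nl (linkSym ψ l')) mw'))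
        where
        m' : Miss ψ v γ
        m' = Recoloured.awayMiss U (subcore≢core dv xT) vw m
        vt : adj r v ≡ false → v ≢ t
        vt pv refl = notBoth (onR s arc) pv

      -- After the toggle `x` misses `γ`, so these are two bad vertices with the roles of `r` and
      -- `x` exchanged.
      bothBad : ∀ {t' d} → OnR t' → OnR d → adj x t' ≡ false → adj x d ≡ false → t' ≢ w → d ≢ w → t' ≢ d →
        Miss φ t' γ → Miss φ d α → ⊥
      bothBad (at , dt) (ad , dd) pt pd tw' dw ne m m' = R.twoBad (turned s') ne at ad (subcore≢core dt xT) (subcore≢core dd xT) pt pd
        (inj₁ (Recoloured.awayMiss U (subcore≢core dt xT) tw' m , Recoloured.awayMiss U (subcore≢core dd xT) dw m'))

      -- As `t` is already joined to `w`, a change at `d` makes `d` miss `α` and leaves `γ` missing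
      -- at `t`, a bad pair at `r`.
      onlyγ : ∀ {d} → OnR d → OnR t → adj x d ≡ false → d ≢ w → t ≢ d → Miss φ d γ → ⊥
      onlyγ {d} (ad , dd) (at , dt) pd dw ne m = joined λ l →
        let m' = Recoloured.awayMiss U (subcore≢core dd xT) dw m
            offd = off s' (subcore≢core dd rT) (subcore≢core dd xT) (inj₂ m')
            nl = λ l' → dw (three ψ (α≢β s') (inj₂ gap') (inj₂ m') (inj₂ mw') l' l (≢-sym ne) (≢-sym tw))
        in splitAdj (λ a → tPriv a) λ pt → flipA s' offd λ χ K s₁ nr →
          R.twoBad (turned s₁) ne at ad (subcore≢core dt xT) (subcore≢core dd xT) pt pd
            (inj₁ (Swapped.outMiss K (λ l' → nl (linkSym ψ l')) gap' , Swapped.missB K ε m'))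

    subcoreOf : ∀ {φ α β v c e} → State φ α β → col φ r v ≡ just c → Miss φ v e → OnR v
    subcoreOf {φ} s p m = onR s p ,
      [ (λ t → ⊥-elim (Counts.noMiss (holeRX s) (≢-sym (coloured⇒≢ φ p)) (x≢ s p) t m)) , (λ d → d) ]′ (coreOrSubcore rT (onR s p))

    -- If t is adjacent to x, the fan can be unwound until r misses the colour missing at t.
    firstMissesγ : ∀ {φ α β w γ t e v} → State φ α β → Bad φ α β w γ → Meets φ w β γ → col φ r t ≡ just β → Miss φ t e → e ≢ γ →
      OnX v → v ≢ w → Miss φ v e → ⊥
    firstMissesγ {φ} {α} {β} {w} {γ} {t} {e} s b mt p m e≢γ ov vw mv =
      splitAdj common λ pt → freeT s b ov vw (subcoreOf s p m) pt e≢α e≢β mv m λ ψ K s₁ nr mα →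
        F.noA s₁ (snoc nil t (trans (Swapped.colOut K nr t) p) mα tt)
      where
      open Meets mt renaming (t to t')
      e≢α : e ≢ α
      e≢α refl = F.noA s (snoc nil t p m tt)
      e≢β : e ≢ β
      e≢β refl = F.fanHole s (reached nil p m) (missX s)
      T = toggle s (missW b) (colXW b)
      s' = proj₁ (proj₂ (proj₂ T))
      U = proj₁ (proj₂ T)
      rw = r≢ s (colXW b)
      away = Recoloured.away U (OneHole.r≢z (holeRX s)) rw
      gap' = Recoloured.awayMiss U (x≢ s arc) tw gap
      rest : FanPath φ r (λ v e → avoids w v e × e ≢ γ) e tip
      rest with uncons ld
      ... | inj₁ refl with colProper φ p arc
      ...   | refl = ⊥-elim (e≢γ (uniqueMissingNbr s p m gap))
      rest | inj₂ (_ , _ , p' , m' , _ , N) with colProper φ p p'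
      ...   | refl rewrite uniqueMissingNbr s p m m' = N
      rest' : FanPath (proj₁ T) r (λ v e → avoids w v e × e ≢ γ × e ≢ α × e ≢ β) e tip
      rest' = togglePath s U rw proj₁ (mapPath (λ { M a b (c , d) → a , b , c , d ,
        (λ { refl → F.noA s (concatPath (snoc nil t p m tt) (snoc (forget M) _ a b tt)) }) ,
        (λ { refl → F.fanHole s (reached (concatPath (snoc nil t p m tt) (forget M)) a b) (missX s) }) }) rest)
      common : adj x t ≡ true → ⊥
      common adjXW = flipA s' offt λ χ K s₁ nr → unwind χ K s₁ nr
        (snoc (mapPath (λ _ a b (_ , _ , _ , c) → a , b , c) (swapPath K nr (λ { (_ , a , c , _) → c , a }) rest')) t'
          (trans (Swapped.colOut K nr t') (trans (away t') arc)) (Swapped.missB K ε gap') (α≢β s))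
        where
        offt = off s' (≢-sym (coloured⇒≢ φ arc)) (x≢ s arc) (inj₂ gap')
        unwind : ∀ χ → Swapped (proj₁ T) χ α γ t' → State χ α γ → ¬ Link (proj₁ T) α γ t' r → FanPath χ r (λ _ e → e ≢ β) e α → ⊥
        -- Unwinding makes `r` miss `e`. The fan from `e` never hands over `β`, so the edge `r t`
        -- keeps its colour and the common neighbour `t` still misses `e`.
        unwind χ K s₁ nr N with unwindAll (missR s₁) N
        ... | ω , D = commonα s₂ (onR s p) adjXW (Unwound.outMiss D (≢-sym (coloured⇒≢ φ p)) unchanged mt₁)
          where
          s₂ : State ω e γ
          s₂ = state (holeUnwound D (holeRX s₁)) (Unwound.miss D)
            (Unwound.outMiss D (≢-sym (OneHole.r≢z (holeRX s))) (Unwound.non D (OneHole.hole (holeRX s₁))) (missX s₁))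
          p₁ : col χ r t ≡ just β
          p₁ = trans (Swapped.colOut K nr t) (trans (away t) p)
          mt₁ : Miss χ t e
          mt₁ = Swapped.missOther K e≢α e≢γ (Recoloured.awayMiss U (x≢ s p) (separate (onR s p) (notAdjR b)) m)
          notβ : ∀ {f} → FanPath χ r (λ _ e → e ≢ β) e f → f ≢ β
          notβ nil = e≢β
          notβ (snoc _ _ _ _ q) = q
          unchanged : col ω r t ≡ col χ r t
          unchanged with Unwound.chg D t
          ... | inj₁ q = q
          ... | inj₂ (f , M , q) = ⊥-elim (notβ M (same q p₁))

    shortMeets : ∀ {φ α β w γ t} → Bad φ α β w γ → State φ α β → col φ r t ≡ just β → Miss φ t γ → Meets φ w β γ
    shortMeets b s p m = meets _ nil p m (separate (onR s p) (notAdjR b))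

    -- By `shortFan` and `tPriv` no neighbour of `r` of degree `k - 1` is adjacent to `x`; among
    -- three of them, at least two differ from `t`.
    finish : ∀ {φ α β w γ t} → State φ α β → Bad φ α β w γ → col φ r t ≡ just β → Miss φ t γ →
      (∀ d d' → OnR d → OnR d' → adj x d ≡ false → adj x d' ≡ false → t ≢ d → t ≢ d' → d ≢ d' → ⊥) → ⊥
    finish {φ} {t = t} s b p m f = threeSubcore rT xT (rx s) λ d₁ d₂ d₃ a₁ a₂ a₃ i₁ i₂ i₃ n₁₂ n₁₃ n₂₃ →
      own a₁ i₁ λ p₁ → own a₂ i₂ λ p₂ → own a₃ i₃ λ p₃ →
      choose d₁ d₂ d₃ (a₁ , i₁) (a₂ , i₂) (a₃ , i₃) p₁ p₂ p₃ n₁₂ n₁₃ n₂₃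
      where
      M = shortMeets b s p m
      own : ∀ {d} → adj r d ≡ true → IsSubcore d → (adj x d ≡ false → ⊥) → ⊥
      own a i g = splitAdj (λ ad → shortFan s (λ { refl → tPriv s b M ad }) (≢-sym (separate a (notAdjR b))) (separate (onR s p) (notAdjR b)) p m
        (colXW b) (missW b) a ad i) g
      choose : ∀ d₁ d₂ d₃ → OnR d₁ → OnR d₂ → OnR d₃ → adj x d₁ ≡ false → adj x d₂ ≡ false → adj x d₃ ≡ false →
        d₁ ≢ d₂ → d₁ ≢ d₃ → d₂ ≢ d₃ → ⊥
      choose d₁ d₂ d₃ o₁ o₂ o₃ p₁ p₂ p₃ n₁₂ n₁₃ n₂₃ with t ≟ d₁ | t ≟ d₂
      ... | yes refl | _ = f d₂ d₃ o₂ o₃ p₂ p₃ n₁₂ n₁₃ n₂₃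
      ... | no n₁ | yes refl = f d₁ d₃ o₁ o₃ p₁ p₃ n₁ n₂₃ n₁₃
      ... | no n₁ | no n₂ = f d₁ d₂ o₁ o₂ p₁ p₂ n₁ n₂ n₁₂

    -- If `d` misses `α` or `γ`, there is a bad pair at `r`. A missing `β` off the chain of `w`, and
    -- any colour shared with a suitable neighbour of `x`, can be changed to `α`. The two
    -- continuations are the cases that survive.
    noOther : ∀ {φ α β w γ t d e} → State φ α β → Bad φ α β w γ → col φ r t ≡ just β → Miss φ t γ →
      OnR d → adj x d ≡ false → t ≢ d → Miss φ d e → (e ≡ β → Link φ α β w d → ⊥) →
      (e ≢ α → e ≢ β → e ≢ γ → (∀ v → OnX v → v ≢ w → Miss φ v e → ⊥) → ⊥) → ⊥
    noOther {φ} {α} {β} {w} {γ} {t} {d} {e} s b p m od pd td me onβ cov =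
      splitAdj (tPriv s b (shortMeets b s p m)) go
      where
      ot = subcoreOf s p m
      dw = separate (proj₁ od) (notAdjR b)
      tw = separate (onR s p) (notAdjR b)
      γα = ≢-sym (γ≢α s (missW b) (colXW b))
      γβ : γ ≢ β
      γβ refl = missX s _ (colXW b)
      end : ∀ {χ} → State χ α β → Bad χ α β w γ → col χ r t ≡ just β → Miss χ t γ → adj x t ≡ false → Miss χ d α → ⊥
      end s₁ b₁ p₁ m₁ pt md = bothBad s₁ b₁ (shortMeets b₁ s₁ p₁ m₁) ot od pt pd tw dw td m₁ md
      go : adj x t ≡ false → ⊥
      go pt with e ≟ α | e ≟ β | e ≟ γ
      ... | yes refl | _ | _ = end s b p m pt me
      ... | no _ | _ | yes refl = onlyγ s b (shortMeets b s p m) od ot pd dw td me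
      ... | no ea | no eb | no eg = cov ea eb eg λ v ov vw mv → freeT s b ov vw od pd ea eb mv me λ ψ K s₁ nr md →
        end s₁ (bad (adjXW b) (notAdjR b) (w≢r b) (Swapped.missOther K (≢-sym (α≢β s)) (≢-sym eb) (missW b)) (Swapped.keepOther K γα (≢-sym eg) (colXW b)))
          (trans (Swapped.colOut K nr t) p) (Swapped.missOther K γα (≢-sym eg) m) pt md
      ... | no _ | yes refl | no _ = splitLink φ α β w d (onβ refl) λ nl → flipA s offd λ χ K s₁ nr →
        end s₁ (bad (adjXW b) (notAdjR b) (w≢r b) (Swapped.outMiss K (λ l → nl (linkSym φ l)) (missW b)) (trans (Swapped.colOut K (xOff s offd) w) (colXW b)))
          (trans (Swapped.colOut K nr t) p) (Swapped.missOther K γα γβ m) pt (Swapped.missB K ε me)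
        where offd = off s (subcore≢core (proj₂ od) rT) (subcore≢core (proj₂ od) xT) (inj₂ me)

    module Cover {φ α β w γ} (s : State φ α β) (b : Bad φ α β w γ) (mt : Meets φ w β γ)
      (noB : ∀ v → OnX v → v ≢ w → Miss φ v β → ⊥) where

      -- At least `k - 3` neighbours of `x` other than `w` miss distinct colours, none of them `α`,
      -- `β` or `γ`, so every other colour occurs among them.
      cov : ∀ {e} → e ≢ α → e ≢ β → e ≢ γ → (∀ v → OnX v → v ≢ w → Miss φ v e → ⊥) → ⊥
      cov ea eb eg f = cover s (w ∷ []) (γ ∷ []) refl
        ((ea ∷ eb ∷ eg ∷ []) ∷ (α≢β s ∷ γ≢α s (missW b) (colXW b) ∷ []) ∷ ((λ { refl → missX s _ (colXW b) }) ∷ []) ∷ [] ∷ [])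
        nb (λ { v v' e ov ov' (vw ∷ []) (vw' ∷ []) ne m m' → apartX s b ov ov' vw vw' ne
                  (All.head (nb v e ov (vw ∷ []) m)) (All.head (All.tail (nb v e ov (vw ∷ []) m))) m m' })
        (λ { v ov (vw ∷ []) → f v ov vw })
        where
        nb : ∀ v e → OnX v → All (v ≢_) (w ∷ []) → Miss φ v e → All (e ≢_) (α ∷ β ∷ γ ∷ [])
        nb v e ov (vw ∷ []) m = (λ { refl → noBadα s b ov vw m }) ∷ (λ { refl → noB v ov vw m }) ∷ (λ { refl → noγ s b mt ov vw m }) ∷ []

      conclude : ∀ {t} → col φ r t ≡ just β → Miss φ t γ → ⊥
      conclude p m = finish s b p m λ d d' od od' pd pd' td td' dd' →
        -- Both `d` and `d'` are forced to miss `β` on the chain of `w`, which has room for only one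
        -- of them.
        noOther s b p m od pd td (proj₂ (missingAt s (proj₂ od))) (λ e l →
          noOther s b p m od' pd' td' (proj₂ (missingAt s (proj₂ od'))) (λ e' l' →
            dd' (three φ (α≢β s) (inj₂ (missW b)) (inj₂ (subst (Miss φ d) e (proj₂ (missingAt s (proj₂ od)))))
              (inj₂ (subst (Miss φ d') e' (proj₂ (missingAt s (proj₂ od'))))) l l'
              (separate (proj₁ od) (notAdjR b)) (separate (proj₁ od') (notAdjR b)))) cov) cov

    -- Either the first fan vertex already misses `γ`, or it misses a colour that by the count is
    -- also missing at a neighbour of `x`.
    noSingleBad : ∀ {φ α β w γ} → State φ α β → Bad φ α β w γ → Meets φ w β γ →
      (∀ v → OnX v → v ≢ w → Miss φ v β → ⊥) → ⊥
    noSingleBad {φ} {α} {β} {w} {γ} s b mt noB with uncons (Meets.ld mt)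
    ... | inj₁ refl = Cover.conclude s b mt noB (Meets.arc mt) (Meets.gap mt)
    ... | inj₂ (t , e , p , m , (_ , ne) , _) = Cover.cov s b mt noB (λ { refl → F.noA s (snoc nil t p m tt) })
      (λ { refl → F.fanHole s (reached nil p m) (missX s) }) ne λ v ov vw mv → firstMissesγ s b mt p m ne ov vw mv

    module Twin {φ α β w γ v κ} (s : State φ α β) (b : Bad φ α β w γ) (b₂ : Bad φ α β v κ) (vw : v ≢ w)
      (dw : IsSubcore w) (dv : IsSubcore v) (mt : Meets φ w β γ) (mt₂ : Meets φ v β κ) where

      κ≢γ : κ ≢ γ
      κ≢γ refl = vw (colProper φ (colXW b₂) (colXW b))

      linked : ¬ ¬ Link φ α β w v
      linked = linkβ s b (adjXW b₂ , dv) vw (missW b₂)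

      only : ∀ {u} → u ≢ w → u ≢ v → Miss φ u β → Link φ α β w u → ⊥
      only uw uv m l = linked λ l' → uv (three φ (α≢β s) (inj₂ (missW b)) (inj₂ m) (inj₂ (missW b₂)) l l' uw vw)

      -- Two vertices, `w` and `v`, are set aside together with two colours, `γ` and `κ`, so the
      -- count of `Cover` still balances.
      cov : ∀ {e} → e ≢ α → e ≢ β → e ≢ γ → e ≢ κ → (∀ u → OnX u → u ≢ w → u ≢ v → Miss φ u e → ⊥) → ⊥
      cov ea eb eg ek f = cover s (w ∷ v ∷ []) (γ ∷ κ ∷ []) refl
        ((ea ∷ eb ∷ eg ∷ ek ∷ []) ∷ (α≢β s ∷ γ≢α s (missW b) (colXW b) ∷ γ≢α s (missW b₂) (colXW b₂) ∷ []) ∷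
          ((λ { refl → missX s _ (colXW b) }) ∷ (λ { refl → missX s _ (colXW b₂) }) ∷ []) ∷ (≢-sym κ≢γ ∷ []) ∷ [] ∷ [])
        nb (λ { u u' e ou ou' (uw ∷ uv) (uw' ∷ _) ne m m' → apartX s b ou ou' uw uw' ne
                  (All.head (nb u e ou (uw ∷ uv) m)) (All.head (All.tail (nb u e ou (uw ∷ uv) m))) m m' })
        (λ { u ou (uw ∷ uv ∷ []) → f u ou uw uv })
        where
        nb : ∀ u e → OnX u → All (u ≢_) (w ∷ v ∷ []) → Miss φ u e → All (e ≢_) (α ∷ β ∷ γ ∷ κ ∷ [])
        nb u e ou (uw ∷ uv ∷ []) m = (λ { refl → noBadα s b ou uw m }) ∷ (λ { refl → linkβ s b ou uw m (only uw uv m) }) ∷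
          (λ { refl → noγ s b mt ou uw m }) ∷ (λ { refl → noγ s b₂ mt₂ ou uv m }) ∷ []

      conclude : ∀ {t} → col φ r t ≡ just β → Miss φ t γ → ⊥
      conclude {t} p m = finish s b p m λ d d' od od' pd pd' td td' dd' → split od od' pd pd' td td' dd'
        where
        one : ∀ {d} → OnR d → adj x d ≡ false → t ≢ d → Meets.t mt₂ ≢ d → ⊥
        one {d} od pd td t₂d = noOther s b p m od pd td md
            (λ e l → only dw' dv' (subst (Miss φ d) e md) l)
            λ ea eb eg f → isκ ea eb eg f
          where
          e = proj₁ (missingAt s (proj₂ od))
          md = proj₂ (missingAt s (proj₂ od))
          dw' = separate (proj₁ od) (notAdjR b)
          dv' = separate (proj₁ od) (notAdjR b₂)
          isκ : e ≢ α → e ≢ β → e ≢ γ → (∀ v → OnX v → v ≢ w → Miss φ v e → ⊥) → ⊥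
          isκ ea eb eg f with e ≟ κ
          ... | no ek = cov ea eb eg ek λ u ou uw _ → f u ou uw
          ... | yes q = onlyγ s b₂ mt₂ od (subcoreOf s (Meets.arc mt₂) (Meets.gap mt₂)) pd dv' t₂d (subst (Miss φ d) q md)
        split : ∀ {d d'} → OnR d → OnR d' → adj x d ≡ false → adj x d' ≡ false → t ≢ d → t ≢ d' → d ≢ d' → ⊥
        -- The colour `κ` is excluded at `d` only if `d` is not itself the vertex where the fan
        -- meets `κ`; one of `d` and `d'` is not.
        split {d} od od' pd pd' td td' dd' with Meets.t mt₂ ≟ d
        ... | no q = one od pd td q
        ... | yes q = one od' pd' td' λ q' → dd' (trans (sym q) q')

    noTwinBad : ∀ {φ α β w γ v κ} → State φ α β → Bad φ α β w γ → Bad φ α β v κ → v ≢ w → IsSubcore w → IsSubcore v →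
      Meets φ w β γ → Meets φ v β κ → ⊥
    noTwinBad {κ = κ} s b b₂ vw dw dv mt mt₂ with uncons (Meets.ld mt)
    ... | inj₁ refl = Twin.conclude s b b₂ vw dw dv mt mt₂ (Meets.arc mt) (Meets.gap mt)
    ... | inj₂ (t , e , p , m , (_ , ne) , _) with e ≟ κ
    ...   | yes refl = Twin.conclude s b₂ b (≢-sym vw) dv dw mt₂ mt p m
    ...   | no nk = Twin.cov s b b₂ vw dw dv mt mt₂ (λ { refl → F.noA s (snoc nil t p m tt) })
      (λ { refl → F.fanHole s (reached nil p m) (missX s) }) ne nk λ u ou uw _ mu → firstMissesγ s b mt p m ne ou uw mu

    -- Applied to `v`, `orient` gives a second bad vertex with its own meeting point, or a fan
    -- vertex missing `β`. The latter would be a third end of the chain joining `w` and `v`.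
    noSecondBad : ∀ {φ α β w γ v} → State φ α β → Bad φ α β w γ → Meets φ w β γ → IsSubcore w → OnX v → v ≢ w → Miss φ v β → ⊥
    noSecondBad {φ} {α} {β} {v = v} s b mt dw (av , dv) vw m =
      splitAdj (λ a → commonβ s a av m) λ pv → go pv (colX s av (subcore≢core dv rT))
      where
      go : adj r v ≡ false → (∃ λ κ → col φ x v ≡ just κ) → ⊥
      go pv (κ , cv) = orient s m cv (λ L → noTwinBad s b b₂ vw dw dv mt (meetsAtγ s b₂ L)) turnBack
        where
        b₂ : Bad φ α β v κ
        b₂ = bad av pv (subcore≢core dv rT) m cv
        turnBack : ∀ ψ → Recoloured φ ψ x v (just β) → State ψ α κ → Miss ψ v κ → col ψ x v ≡ just β → FanPath ψ r (avoids v) κ β → ⊥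
        turnBack ψ U s' _ _ L with togglePath⁻ s' U (r≢ s cv) (λ q → q) L
        ... | nil = missX s _ cv
        ... | snoc M u p mu uv = pathEndLinked s m cv M p mu uv λ l → linkβ s b (av , dv) vw m λ l' →
          separate (onR s p) (notAdjR b) (three φ (α≢β s) (inj₂ m) (inj₂ mu) (inj₂ (missW b)) (linkSym φ l) (linkSym φ l') uv (≢-sym vw))

    -- Toggling `x w` keeps `w` bad with `β` and `γ` exchanged, so the fan may be assumed to lead
    -- from the missing colour to the colour of `x w`.
    noBadVertex : ∀ {φ α β w γ} → State φ α β → Bad φ α β w γ → IsSubcore w → ⊥
    noBadVertex s b dw = orient s (missW b) (colXW b) (typeII s b)
      λ ψ U s' mw' cw' L → typeII s' (bad (adjXW b) (notAdjR b) (w≢r b) mw' cw') L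
      where
      typeII : ∀ {φ α β γ} → State φ α β → Bad φ α β _ γ → FanPath φ r (avoids _) β γ → ⊥
      typeII s b L = noSingleBad s b (meetsAtγ s b L) λ v ov vw m → noSecondBad s b (meetsAtγ s b L) dw ov vw m

-- Neighbourhoods of core vertices

module Neighbourhoods {n : ℕ} (k : ℕ) (G : SimpleGraph n) (deg≤ : ∀ v → deg G v ≤ k)
  (core≤2 : ∀ v → deg G v ≡ k → ∣ Nd G k v ∣ ≤ 2)
  (nc : Moves.Graph.NonCol n k G)
  (crit : ∀ {u v} → SimpleGraph.adj G u v ≡ true → (∀ φ → Moves.Graph.OneHole n k G φ u v → ⊥) → ⊥)
  (5≤k : 5 ≤ k) where

  open CoreEdges k G deg≤ core≤2 nc crit 5≤k public
  open SimpleGraph G using (adj)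

  module Shared (r x : V) (rT : IsCore r) (xT : IsCore x) where
    open PrivateVertex r x rT xT
    open Pair r x rT xT
    open State
    module XR = PrivateVertex x r xT rT

    badR : ∀ {φ α β t} → State φ α β → OnR t → adj x t ≡ false → Miss φ t α → ⊥
    badR s (at , dt) pt m with colR s at (subcore≢core dt xT)
    ... | γ , c = XR.noBadVertex (turned s) (XR.bad at pt (subcore≢core dt xT) m c) dt

    badX : ∀ {φ α β v} → State φ α β → OnX v → Miss φ v β → ⊥
    badX {φ} {v = v} s (av , dv) m = splitAdj (λ a → commonβ s a av m) λ pv → go pv (colX s av (subcore≢core dv rT))
      where
      go : adj r v ≡ false → (∃ λ γ → col φ x v ≡ just γ) → ⊥
      go pv (γ , c) = noBadVertex s (bad av pv (subcore≢core dv rT) m c) dv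

    badXα : ∀ {φ α β v} → State φ α β → OnX v → Miss φ v α → ⊥
    badXα s (av , dv) m = flipA s (off s (subcore≢core dv rT) (subcore≢core dv xT) (inj₁ m)) λ χ K s₁ _ → badX s₁ (av , dv) (Swapped.missA K ε m)

    badRβ : ∀ {φ α β t} → State φ α β → OnR t → adj x t ≡ false → Miss φ t β → ⊥
    badRβ s (at , dt) pt m = flipA s (off s (subcore≢core dt rT) (subcore≢core dt xT) (inj₂ m)) λ χ K s₁ _ → badR s₁ (at , dt) pt (Swapped.missB K ε m)

    linkR : ∀ {φ α β v c} → State φ α β → OnX v → Miss φ v c → ¬ ¬ Link φ α c r v
    linkR s ov m nl = flipA s nl λ χ K s₁ _ → badXα s₁ ov (Swapped.missB K ε m)

    -- With no bad vertices left, at least `k - 2` neighbours of `x` miss distinct colours other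
    -- than `α` and `β`, which are all such colours. One of them shares the colour missing at `t`
    -- and occupies the chain of `r`, so `t` can be changed to miss `α` and is bad for `r`.
    shared : adj r x ≡ true → ∀ {t} → OnR t → adj x t ≡ false → ⊥
    shared a {t} ot@(at , dt) pt = crit a λ φ S →
      go (state S (proj₂ (Counts.missingAtEnd S (deg≤ r))) (proj₂ (Counts.missingAtEnd (holeSym S) (deg≤ x))))
      where
      go : ∀ {φ α β} → State φ α β → ⊥
      go {φ} {α} {β} s with missingAt s dt
      ... | c , mt = cover s [] [] refl ((cα ∷ cβ ∷ []) ∷ (α≢β s ∷ []) ∷ [] ∷ []) nb inj final
        where
        cα : c ≢ α
        cα refl = badR s ot pt mt
        cβ : c ≢ β
        cβ refl = badRβ s ot pt mt
        nb : ∀ v e → OnX v → All (v ≢_) [] → Miss φ v e → All (e ≢_) (α ∷ β ∷ [])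
        nb v e ov _ m = (λ { refl → badXα s ov m }) ∷ (λ { refl → badX s ov m }) ∷ []
        inj : ∀ v v' e → OnX v → OnX v' → All (v ≢_) [] → All (v' ≢_) [] → v ≢ v' → Miss φ v e → Miss φ v' e → ⊥
        inj v v' e ov ov' _ _ ne m m' = linkR s ov m λ l → linkR s ov' m' λ l' →
          ne (three φ (≢-sym (All.head (nb v e ov [] m))) (inj₁ (missR s)) (inj₂ m) (inj₂ m') l l' (subcore≢core (proj₂ ov) rT) (subcore≢core (proj₂ ov') rT))
        final : ∀ v → OnX v → All (v ≢_) [] → Miss φ v c → ⊥
        final v ov _ m = linkR s ov m λ l → splitLink φ α c r t
          (λ l' → separate (proj₁ ov) pt (three φ (≢-sym cα) (inj₁ (missR s)) (inj₂ m) (inj₂ mt) l l' (subcore≢core (proj₂ ov) rT) (subcore≢core dt rT)))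
          λ nl → flipA s nl λ χ K s₁ _ → badR s₁ ot pt (Swapped.missB K ε mt)

  SubcoreNbr : V → V → Set
  SubcoreNbr r v = adj r v ≡ true × IsSubcore v

  sharedNeighbour : ∀ {r x t} → IsCore r → IsCore x → adj r x ≡ true → SubcoreNbr r t → adj x t ≡ true
  sharedNeighbour {r} {x} {t} rT xT a o with adj x t in eq
  ... | true = refl
  ... | false = ⊥-elim (Shared.shared r x rT xT a o eq)

  -- An uncoloured edge from a core vertex to a vertex of degree k - 1

  module Hole {r s : V} (rT : IsCore r) (os : SubcoreNbr r s) where

    sr : s ≢ r
    sr = subcore≢core (proj₂ os) rT

    -- Moving the hole along the fan to a core neighbour y of r makes p a common neighbour of r and y.
    noShared : ∀ {φ α p} → OneHole φ r s → Miss φ r α → SubcoreNbr r p → p ≢ s → Miss φ p α → ⊥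
    noShared {φ} {α} {p} S missR op ps mp with Counts.missingAtEnd (holeSym S) (deg≤ s)
    ... | a , ma = Crit.fanEndsInCore S missR ma λ y d L py ay ys yT → move y d L py ay ys yT (uncolourEdge φ (coloured⇒≢ φ py))
      where
      move : ∀ y d → FreeFanPath φ r a d → col φ r y ≡ just d → adj r y ≡ true → y ≢ s → IsCore y →
        (∃ λ ψ → Recoloured φ ψ r y nothing) → ⊥
      move y d L py ay ys yT (φ₁ , U₁) = shift (unwindAll (Recoloured.gainP U₁ ry py (λ ())) L₁)
        where
        ry = coloured⇒≢ φ py
        L₁ : FreeFanPath φ₁ r a d
        L₁ with truncate U₁ py L
        ... | inj₁ (M , _) = M
        ... | inj₂ (M , _) = M
        back₁ : ∀ {e} → FreeFanPath φ₁ r a e → FreeFanPath φ r a e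
        back₁ = mapPath λ {_} {v} M q m _ → let vy = notY v q in
          trans (sym (Recoloured.atP U₁ ry vy)) q ,
          (λ w e → m w (trans (Recoloured.away U₁ (≢-sym (coloured⇒≢ φ₁ q)) vy w) e)) , _
          where
          notY : ∀ v {f} → col φ₁ r v ≡ just f → v ≢ y
          notY v q refl with trans (sym (Recoloured.new U₁)) q
          ... | ()
        noα : FreeFanPath φ₁ r a α → ⊥
        noα M = noPath nc S ma missR (back₁ M)
        mp₁ : Miss φ₁ p α
        mp₁ = Recoloured.awayMiss U₁ (subcore≢core (proj₂ op) rT) (subcore≢core (proj₂ op) yT) mp
        rs₁ : col φ₁ r s ≡ nothing
        rs₁ = trans (Recoloured.atP U₁ ry (≢-sym ys)) (OneHole.hole S)
        shift : ∃ (Unwound φ₁ r (FreeFanPath φ₁ r a) a) → ⊥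
        shift (φ₂ , D) with recolourEdge φ₂ (≢-sym sr) (Unwound.miss D) ms₂
          where
          ms₂ : Miss φ₂ s a
          ms₂ = Unwound.outMiss D sr (Unwound.non D rs₁) (Recoloured.awayMiss U₁ sr (≢-sym ys) ma)
        -- Were `α` at `r`, or the edge `r p`, affected by the unwinding, the original fan would
        -- have arrived at `α`.
        ... | φ₃ , U₃ with Unwound.keep D (Recoloured.missP U₁ ry missR (λ ())) | Unwound.chg D p
        ...   | inj₂ M | _ = noα M
        ...   | _ | inj₂ (f , M , q) = noα (snoc M p q mp₁ _)
        ...   | inj₁ mr₂ | inj₁ q = Pair.commonα r y rT yT (Pair.state S₃
            (Recoloured.missP U₃ (≢-sym sr) mr₂ (λ { refl → clash nc S missR ma }))
            (Recoloured.awayMiss U₃ (≢-sym ry) ys (Unwound.outMiss D (≢-sym ry) (Unwound.non D (Recoloured.new U₁))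
              (Recoloured.gainP (recolouredSym U₁) (≢-sym ry) (flip φ py) (λ ())))))
            (proj₁ op) (sharedNeighbour rT yT ay op)
            (Recoloured.awayMiss U₃ (subcore≢core (proj₂ op) rT) ps (Unwound.outMiss D (subcore≢core (proj₂ op) rT) q mp₁))
          where
          S₃ : OneHole φ₃ r y
          S₃ = record { edge = ay ; on = on' ; cov = cov' ; hole = hole' }
            where
            on' : ∀ {u v c} → col φ₃ u v ≡ just c → adj u v ≡ true
            on' {u} {v} x with Edge? r s u v
            ... | yes (inj₁ (refl , refl)) = proj₁ os
            ... | yes (inj₂ (refl , refl)) = adjSym (proj₁ os)
            ... | no ne with unwound⁻ D (trans (sym (Recoloured.old U₃ ne)) x)
            ...   | _ , x₁ with Edge? r y u v
            ...     | yes (inj₁ (refl , refl)) = ay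
            ...     | yes (inj₂ (refl , refl)) = adjSym ay
            ...     | no ne' = OneHole.on S (trans (sym (Recoloured.old U₁ ne')) x₁)
            cov' : ∀ {u v} → adj u v ≡ true → ((u ≡ r × v ≡ y) ⊎ (u ≡ y × v ≡ r)) ⊎ ∃ λ c → col φ₃ u v ≡ just c
            cov' {u} {v} h with Edge? r y u v | Edge? r s u v
            ... | yes e | _ = inj₁ e
            ... | no _ | yes (inj₁ (refl , refl)) = inj₂ (_ , Recoloured.new U₃)
            ... | no _ | yes (inj₂ (refl , refl)) = inj₂ (_ , flip φ₃ (Recoloured.new U₃))
            ... | no ne | no ne' with OneHole.cov S h
            ...   | inj₁ e = ⊥-elim (ne' e)
            ...   | inj₂ (_ , x) = inj₂ (_ , trans (Recoloured.old U₃ ne') (proj₂ (unwound⁺ D (trans (Recoloured.old U₁ ne) x))))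
            hole' : col φ₃ r y ≡ nothing
            hole' = trans (Recoloured.atP U₃ (≢-sym sr) ys) (trans (Unwound.non D (Recoloured.new U₁)) (Recoloured.new U₁))

    In : V → Set
    In p = p ≡ r ⊎ SubcoreNbr r p

    linkIn : ∀ {φ α p c} → OneHole φ r s → Miss φ r α → SubcoreNbr r p → Miss φ p c → ¬ ¬ Link φ α c r p
    linkIn {φ} {α} {p} {c} S missR op mp nl with p ≟ s
    ... | yes refl = holeLinked nc S missR mp nl
    ... | no ps = swapComponent φ α c p λ ψ K →
      noShared (holeSwapped K S) (Swapped.outMiss K (λ l → nl (linkSym φ l)) missR) op ps (Swapped.missB K ε mp)

    -- For two vertices other than `r`, both would be joined to `r` by the chain with a colour
    -- missing at `r`.
    disjoint : ∀ {φ p q c} → OneHole φ r s → In p → In q → p ≢ q → Miss φ p c → Miss φ q c → ⊥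
    disjoint S (inj₁ refl) (inj₁ refl) ne _ _ = ne refl
    disjoint {q = q} S (inj₁ refl) (inj₂ oq) ne mp mq with q ≟ s
    ... | yes refl = clash nc S mp mq
    ... | no qs = noShared S mp oq qs mq
    disjoint S (inj₂ op) (inj₁ refl) ne mp mq = disjoint S (inj₁ refl) (inj₂ op) (≢-sym ne) mq mp
    disjoint {φ} S (inj₂ op) (inj₂ oq) ne mp mq with Counts.missingAtEnd S (deg≤ r)
    ... | α , missR = linkIn S missR op mp λ l → linkIn S missR oq mq λ l' →
      ne (three φ (λ { refl → disjoint S (inj₁ refl) (inj₂ op) (λ { refl → subcore≢core (proj₂ op) rT refl }) missR mp })
        (inj₁ missR) (inj₂ mp) (inj₂ mq) l l' (subcore≢core (proj₂ op) rT) (subcore≢core (proj₂ oq) rT))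

    -- Otherwise a change at `p` would make both vertices miss `d`.
    linkPair : ∀ {φ p q c d} → OneHole φ r s → In p → In q → p ≢ q → Miss φ p c → Miss φ q d → ¬ ¬ Link φ c d p q
    linkPair {φ} {p} {c = c} {d} S ip iq ne mp mq nl = swapComponent φ c d p λ ψ K →
      disjoint (holeSwapped K S) ip iq ne (Swapped.missA K ε mp) (Swapped.outMiss K nl mq)

    twoMissing : ∀ {φ} → OneHole φ r s → ∃ λ a → ∃ λ b → b ≢ a × Miss φ s a × Miss φ s b
    twoMissing S with Counts.missingAtEnd (holeSym S) (deg≤ s)
    ... | a , ma with Counts.another (holeSym S) (subst (deg G s <_) (proj₂ os) (ℕ.n<1+n _)) ma
    ...   | b , ne , mb = a , b , ne , ma , mb

    module Far {x : V} (xT : IsCore x) (a : adj r x ≡ true) where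

      -- The count is exact: `r` misses a colour, `s` two, and at least `k - 3` further neighbours
      -- one each, all distinct, which exhausts the `k` colours.
      covered : ∀ {φ e} → OneHole φ r s → (∀ p → In p → Miss φ p e → ⊥) → ⊥
      covered {φ} {e} S f with Counts.missingAtEnd S (deg≤ r) | twoMissing S
      ... | α , missR | c , d , dc , mc , md = subcoreExceptTwo rT xT a λ y isd →
        let p = minus (N G r) (x ∷ y ∷ s ∷ [])
            on : ∀ v → v ∈ p → SubcoreNbr r v × v ≢ s
            on v h = let (h₁ , vs) = ∈minus (N G r) (x ∷ y ∷ s ∷ []) h
                     in (N∈ G h₁ , isd v (N∈ G h₁) (All.head vs) (All.head (All.tail vs))) , All.head (All.tail (All.tail vs))
            m : ∀ v h → ∃ (Miss φ v)
            m v h = Counts.missing S (subst (deg G v <_) (proj₂ (proj₁ (on v h))) (ℕ.n<1+n _))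
            is : In s
            is = inj₂ os
        in ℕ.<-irrefl refl (ℕ.≤-trans (s≤s (ℕ.≤-trans (ℕ.≤-reflexive (sym rT)) (∣minus∣ (N G r) (x ∷ y ∷ s ∷ []))))
             (ℕ.≤-trans (ℕ.≤-reflexive (sym (ℕ.+-suc ∣ p ∣ 3)))
               (avoid p (e ∷ α ∷ c ∷ d ∷ [])
                 (((λ { refl → f r (inj₁ refl) missR }) ∷ (λ { refl → f s is mc }) ∷ (λ { refl → f s is md }) ∷ []) ∷
                  ((λ { refl → clash nc S missR mc }) ∷ (λ { refl → clash nc S missR md }) ∷ []) ∷ (≢-sym dc ∷ []) ∷ [] ∷ [])
                 (λ v h → proj₁ (m v h))
                 (λ v h → let ov = proj₁ (on v h) ; vs = proj₂ (on v h) ; mv = proj₂ (m v h) in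
                   (λ q → f v (inj₂ ov) (subst (Miss φ v) q mv)) ∷
                   (λ q → disjoint S (inj₂ ov) (inj₁ refl) (subcore≢core (proj₂ ov) rT) (subst (Miss φ v) q mv) missR) ∷
                   (λ q → disjoint S (inj₂ ov) is vs (subst (Miss φ v) q mv) mc) ∷
                   (λ q → disjoint S (inj₂ ov) is vs (subst (Miss φ v) q mv) md) ∷ [])
                 λ v v' h h' e → eqV v v' λ ne → disjoint S (inj₂ (proj₁ (on v h))) (inj₂ (proj₁ (on v' h'))) ne
                   (proj₂ (m v h)) (subst (Miss φ v') (sym e) (proj₂ (m v' h'))))))
        where
        eqV : ∀ (v v' : V) → ¬ (v ≢ v') → v ≡ v'
        eqV v v' q with v ≟ v'
        ... | yes e = e
        ... | no ne = ⊥-elim (q ne)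

      module _ {u w : V} (uT : IsCore u) (us : adj u s ≡ true) (ur : u ≢ r) (uw : adj u w ≡ true) (wD : IsSubcore w)
        (rw : adj r w ≡ false) where

        notIn : ∀ {p} → In p → p ≢ w
        notIn (inj₁ refl) refl = subcore≢core wD rT refl
        notIn (inj₂ (h , _)) refl = notBoth h rw

        ws : w ≢ s
        ws refl = notBoth (proj₁ os) rw

        -- The (c,e)-path from s ends at the vertex of In that misses e, and w is not in In.
        apart : ∀ {φ c e} → OneHole φ r s → Miss φ s c → c ≢ e → End φ c e w → ¬ Link φ c e w s
        apart {φ} {c} {e} S mc ne ew l with Miss? φ s e
        ... | yes me = stay (linkSym φ l)
          where
          stay : ¬ Link φ c e s w
          stay ε = ws refl
          stay (inj₁ q ◅ _) = mc _ q
          stay (inj₂ q ◅ _) = me _ q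
        ... | no nm = covered S λ p ip mp → linkPair S (inj₂ os) ip (λ { refl → nm mp }) mc mp λ l' →
          notIn ip (three φ ne (inj₁ mc) (inj₂ mp) ew l' (linkSym φ l) (λ { refl → nm mp }) ws)

        -- The second colour `d` missing at `s` serves as a stepping stone: `w` is changed from `μ`
        -- to `d` and from `d` to `σ`, without touching `s`. Then `w`, `u`, `s` is a path in `c` and
        -- `σ` that makes `w` a forbidden end.
        atA : ∀ {φ c d σ μ} → OneHole φ r s → c ≢ d → Miss φ s c → Miss φ s d → col φ s u ≡ just σ → col φ w u ≡ just c → Miss φ w μ → ⊥
        atA {φ₀} {c} {d} {σ} S₀ cd mc₀ md₀ ps₀ pw₀ mμ₀ = toD S₀ mc₀ md₀ ps₀ pw₀ mμ₀
          where
          final : ∀ {φ} → OneHole φ r s → Miss φ s c → col φ s u ≡ just σ → col φ w u ≡ just c → Miss φ w σ → ⊥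
          final {φ} S mc ps pw mσ = apart S mc (λ { refl → mc _ ps }) (inj₂ mσ) (inj₁ pw ◅ inj₂ (flip φ ps) ◅ ε)
          toσ : ∀ {φ} → OneHole φ r s → Miss φ s c → Miss φ s d → col φ s u ≡ just σ → col φ w u ≡ just c → Miss φ w d → ⊥
          toσ {φ} S mc md ps pw m = swapComponent φ d σ w λ ψ K →
            let nl = apart S md (λ { refl → md _ ps }) (inj₁ m) in
            final (holeSwapped K S) (Swapped.outMiss K nl mc) (trans (Swapped.colOut K nl u) ps)
              (Swapped.keepOther K cd (λ { refl → mc _ ps }) pw) (Swapped.missA K ε m)
          toD : ∀ {φ μ} → OneHole φ r s → Miss φ s c → Miss φ s d → col φ s u ≡ just σ → col φ w u ≡ just c → Miss φ w μ → ⊥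
          toD {φ} {μ} S mc md ps pw m with d ≟ μ
          ... | yes refl = toσ S mc md ps pw m
          ... | no dμ = swapComponent φ d μ w λ ψ K →
            let nl = apart S md dμ (inj₂ m) in
            toσ (holeSwapped K S) (Swapped.outMiss K nl mc) (Swapped.outMiss K nl md) (trans (Swapped.colOut K nl u) ps)
              (Swapped.keepOther K cd (λ { refl → m _ pw }) pw) (Swapped.missB K ε m)

        -- Once `w` misses `c`, interchanging `c` and `γ` at `w` gives the edge `w u` the colour
        -- `c`.
        anyColour : ∀ {φ c d σ γ μ} → OneHole φ r s → c ≢ d → Miss φ s c → Miss φ s d → col φ s u ≡ just σ → col φ w u ≡ just γ → Miss φ w μ → ⊥
        anyColour {φ₀} {c} {d} {σ} {γ} S₀ cd mc₀ md₀ ps₀ pw₀ m₀ with γ ≟ c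
        ... | yes refl = atA S₀ cd mc₀ md₀ ps₀ pw₀ m₀
        ... | no γc = toC S₀ mc₀ md₀ ps₀ pw₀ m₀
          where
          recolour : ∀ {φ} → OneHole φ r s → Miss φ s c → Miss φ s d → col φ s u ≡ just σ → col φ w u ≡ just γ → Miss φ w c → ⊥
          recolour {φ} S mc md ps pw m = swapComponent φ c γ w λ ψ K →
            let nl = apart S mc (≢-sym γc) (inj₁ m) in
            atA (holeSwapped K S) cd (Swapped.outMiss K nl mc) (Swapped.outMiss K nl md) (trans (Swapped.colOut K nl u) ps)
              (trans (Swapped.colIn K ε pw) (cong just (transpose-b c γ))) (Swapped.missA K ε m)
          toC : ∀ {φ μ} → OneHole φ r s → Miss φ s c → Miss φ s d → col φ s u ≡ just σ → col φ w u ≡ just γ → Miss φ w μ → ⊥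
          toC {φ} {μ} S mc md ps pw m with c ≟ μ
          ... | yes refl = recolour S mc md ps pw m
          ... | no cμ = swapComponent φ c μ w λ ψ K →
            let nl = apart S mc cμ (inj₂ m) in
            recolour (holeSwapped K S) (Swapped.outMiss K nl mc) (Swapped.outMiss K nl md) (trans (Swapped.colOut K nl u) ps)
              (Swapped.keepOther K γc (λ { refl → m _ pw }) pw) (Swapped.missB K ε m)

        far : ⊥
        far = crit (proj₁ os) λ φ S → go S
          where
          go : ∀ {φ} → OneHole φ r s → ⊥
          go {φ} S with twoMissing S | OneHole.cov S (adjSym us) | OneHole.cov S (adjSym uw)
          ... | _ | inj₁ (inj₁ (e , _)) | _ = sr e
          ... | _ | inj₁ (inj₂ (_ , e)) | _ = ur e
          ... | _ | _ | inj₁ (inj₁ (e , _)) = subcore≢core wD rT e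
          ... | _ | _ | inj₁ (inj₂ (_ , e)) = ur e
          ... | c , d , dc , mc , md | inj₂ (σ , ps) | inj₂ (γ , pw) =
            anyColour S (≢-sym dc) mc md ps pw (proj₂ (Counts.missing S (subst (deg G w <_) wD (ℕ.n<1+n _))))

  contained : ∀ {r u s w} → IsCore r → IsCore u → SubcoreNbr r s → adj u s ≡ true → SubcoreNbr u w → adj r w ≡ true
  contained {r} {u} {s} {w} rT uT os us (uw , wD) with adj r w in eq
  ... | true = refl
  ... | false = ⊥-elim (Crit.anotherCore (proj₁ os) λ x adjXW _ xT →
    Hole.Far.far rT os xT adjXW uT us (λ { refl → notBoth uw eq }) uw wD eq)

-- From partial colourings back to the statement

uncolourable : ∀ {n} (G : SimpleGraph n) {k} → Fin k → ¬ EdgeColouring G k → Moves.Graph.NonCol n k G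
uncolourable {n} G {k} c₀ none φ on cov = none (record
  -- The default `c₀` is seen only at pairs that are not edges, since `cov` colours every edge.
  { col = λ u v → fromMaybe c₀ (col φ u v)
  ; col-sym = λ u v _ → cong (fromMaybe c₀) (colSym φ u v)
  ; proper = λ v w w' a a' ne e → ne (differ (cov a) (cov a') e) })
  where
  open Moves n k
  differ : ∀ {v w w'} → (∃ λ c → col φ v w ≡ just c) → (∃ λ c → col φ v w' ≡ just c) →
    fromMaybe c₀ (col φ v w) ≡ fromMaybe c₀ (col φ v w') → w ≡ w'
  differ (c , p) (c' , p') e rewrite p | p' = colProper φ p (trans p' (cong just (sym e)))

meetEqual : ∀ {n} (G : SimpleGraph n) → HZGraph G → 7 ≤ maxDeg G →
  ∀ (u r : Fin n) → deg G u ≡ maxDeg G → deg G r ≡ maxDeg G →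
  Nonempty (Nd G (maxDeg G ∸ 1) u ∩ Nd G (maxDeg G ∸ 1) r) → Nd G (maxDeg G ∸ 1) u ≡ Nd G (maxDeg G ∸ 1) r
meetEqual {n} G (conn , (_ , none) , core≤2) 7≤k u r uT rT (s , h) =
  ⊆-antisym (sub rT uT (∈D r (proj₂ hs)) (∈D u (proj₁ hs))) (sub uT rT (∈D u (proj₁ hs)) (∈D r (proj₂ hs)))
  where
  k = maxDeg G
  hs = x∈p∩q⁻ (Nd G (k ∸ 1) u) (Nd G (k ∸ 1) r) h
  deg≤ : ∀ v → deg G v ≤ k
  deg≤ = ≤foldr (deg G)
  1≤k : 1 ≤ k
  1≤k = ℕ.≤-trans (s≤s z≤n) 7≤k
  open Neighbourhoods k G deg≤ core≤2 (uncolourable G (fromℕ< 1≤k) none)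
    (critical k G conn deg≤ core≤2) (ℕ.≤-trans (s≤s (s≤s (s≤s (s≤s (s≤s z≤n))))) 7≤k)
  ∈D : ∀ v {w} → w ∈ Nd G (k ∸ 1) v → SubcoreNbr v w
  ∈D v i = proj₁ (Nd∈ G i) , trans (cong suc (proj₂ (Nd∈ G i))) (ℕ.m+[n∸m]≡n 1≤k)
  sub : ∀ {v v'} → IsCore v → IsCore v' → SubcoreNbr v s → SubcoreNbr v' s → Nd G (k ∸ 1) v' ⊆ Nd G (k ∸ 1) v
  sub {v} {v'} vT v'T o o' i = ∈Nd G (contained vT v'T o (proj₁ o') (∈D v' i)) (proj₂ (Nd∈ G i))

theorem2p5 : ∀ {n : ℕ} (G : SimpleGraph n) → HZGraph G → 7 ≤ maxDeg G →
    ∀ (u r : Fin n) → deg G u ≡ maxDeg G → deg G r ≡ maxDeg G →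
    Nd G (maxDeg G ∸ 1) u ≢ Nd G (maxDeg G ∸ 1) r →
    Nonempty (Nd G (maxDeg G ∸ 1) u ∩ Nd G (maxDeg G ∸ 1) r) →
    ∣ Nd G (maxDeg G ∸ 1) u ∩ Nd G (maxDeg G ∸ 1) r ∣ ≡ maxDeg G ∸ 3
      × ∣ Nd G (maxDeg G ∸ 1) u ─ Nd G (maxDeg G ∸ 1) r ∣ ≡ 1
      × ∣ Nd G (maxDeg G ∸ 1) r ─ Nd G (maxDeg G ∸ 1) u ∣ ≡ 1
theorem2p5 G hz 7≤k u r uT rT ne both = ⊥-elim (ne (meetEqual G hz 7≤k u r uT rT both))
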